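{- For every multibroom $T$ and every integer $k\ge 1$, there exists $c>0$ such that $\alpha(G)\ge c|G|$ for every $\{T,K_{k+1}\}$-free graph $G$.
   Context: Graphs are finite, with no loops or parallel edges. $|G|$ is the number of vertices of $G$, and $\alpha(G)$ is the size of its largest stable (independent) set. A graph is $\{T,K_{k+1}\}$-free if it has no induced subgraph isomorphic to $T$ and none isomorphic to $K_{k+1}$. A broom is a tree obtained from a path with vertices $v_0,v_1,\ldots,v_\ell$ in order (where $\ell\ge 1$) by adding some number (possibly zero) of new vertices, each adjacent to $v_\ell$ only; $v_0$ is its root and $\ell$ its length. A multibroom is a graph obtained from finitely many vertex-disjoint brooms (of lengths $\ell_1,\ldots,\ell_n\ge 1$) by identifying their roots into a single vertex. -}

module Defs where

open import Data.Empty using (⊥; ⊥-elim)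
open import Data.Fin using (Fin; zero; suc; toℕ; fromℕ)
open import Data.Fin.Properties using (_≟_; all?)
open import Data.Fin.Subset using (Subset; _∈_; ∣_∣; inside; outside) renaming (⊥ to ∅)
open import Data.Fin.Subset.Properties using (_∈?_; ∉⊥)
open import Data.List using (List; []; _∷_; _++_; map; filter)
open import Data.List.Extrema.Nat using (argmax; argmax-all; f[xs]≤f[argmax])
open import Data.List.Membership.Propositional using () renaming (_∈_ to _∈ˡ_)
open import Data.List.Membership.Propositional.Properties
  using (∈-map⁺; ∈-++⁺ˡ; ∈-++⁺ʳ; ∈-filter⁺)
open import Data.List.Relation.Unary.All using (lookup)
open import Data.List.Relation.Unary.All.Properties using (all-filter)
open import Data.List.Relation.Unary.Any using (here)
open import Data.Nat as ℕ using (ℕ; zero; suc; _≤_)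
import Data.Nat.Properties as ℕ
open import Data.Product using (Σ; ∃-syntax; _×_; _,_; proj₁; proj₂)
open import Data.Sum using (_⊎_; inj₁; inj₂; swap)
open import Data.Vec using ([]; _∷_)
open import Function.Bundles using (_↔_; _⇔_; Inverse)
open import Relation.Binary.Core using (Rel)
open import Relation.Binary.Definitions using (Symmetric; Decidable)
open import Relation.Binary.PropositionalEquality using (_≡_; _≢_; refl; sym)
open import Relation.Nullary using (¬_; Dec; yes; no; ¬?)
open import Relation.Nullary.Decidable using (_⊎-dec_; _→-dec_)
open import Level using (0ℓ)

-- Finite graphs are taken with vertex set Fin n; other vertex types only
-- serve to describe particular graphs up to isomorphism.

record Graph (V : Set) : Set₁ where
  field
    Adj    : Rel V 0ℓ
    adj?   : Decidable Adj
    symm   : Symmetric Adj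
    irrefl : ∀ {v} → ¬ Adj v v

open Graph public

record _≅_ {V W : Set} (G : Graph V) (H : Graph W) : Set where
  field
    bijection : V ↔ W
    preserves : ∀ u v → Adj G u v ⇔ Adj H (Inverse.to bijection u) (Inverse.to bijection v)

infix 4 _≅_

order : ∀ {n} → Graph (Fin n) → ℕ
order {n} _ = n

induced : ∀ {n} (G : Graph (Fin n)) (S : Subset n) → Graph (∃[ v ] v ∈ S)
induced G S = record
  { Adj    = λ u v → Adj G (proj₁ u) (proj₁ v)
  ; adj?   = λ u v → adj? G (proj₁ u) (proj₁ v)
  ; symm   = symm G
  ; irrefl = irrefl G
  }

_IsFreeOf_ : ∀ {n} {W : Set} → Graph (Fin n) → Graph W → Set
G IsFreeOf H = ¬ (∃[ S ] induced G S ≅ H)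

complete : ∀ n → Graph (Fin n)
complete n = record
  { Adj    = _≢_
  ; adj?   = λ u v → ¬? (u ≟ v)
  ; symm   = λ u≢v v≡u → u≢v (sym v≡u)
  ; irrefl = λ v≢v → v≢v refl
  }

Stable : ∀ {n} → Graph (Fin n) → Subset n → Set
Stable G S = ∀ u → u ∈ S → ∀ v → v ∈ S → ¬ Adj G u v

stable? : ∀ {n} (G : Graph (Fin n)) (S : Subset n) → Dec (Stable G S)
stable? G S =
  all? λ u → (u ∈? S) →-dec all? λ v → (v ∈? S) →-dec ¬? (adj? G u v)

subsets : ∀ n → List (Subset n)
subsets zero    = [] ∷ []
subsets (suc n) = map (inside ∷_) (subsets n) ++ map (outside ∷_) (subsets n)

largestStable : ∀ {n} → Graph (Fin n) → Subset n
largestStable {n} G = argmax ∣_∣ ∅ (filter (stable? G) (subsets n))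

α : ∀ {n} → Graph (Fin n) → ℕ
α G = ∣ largestStable G ∣

∈-subsets : ∀ {n} (S : Subset n) → S ∈ˡ subsets n
∈-subsets []            = here refl
∈-subsets (inside ∷ S)  = ∈-++⁺ˡ (∈-map⁺ (inside ∷_) (∈-subsets S))
∈-subsets (outside ∷ S) =
  ∈-++⁺ʳ (map (inside ∷_) (subsets _)) (∈-map⁺ (outside ∷_) (∈-subsets S))

largestStable-stable : ∀ {n} (G : Graph (Fin n)) → Stable G (largestStable G)
largestStable-stable {n} G =
  argmax-all ∣_∣ {P = Stable G} (λ _ u∈∅ → ⊥-elim (∉⊥ u∈∅))
    (all-filter (stable? G) (subsets n))

stable⇒∣∣≤α : ∀ {n} (G : Graph (Fin n)) (S : Subset n) → Stable G S → ∣ S ∣ ≤ α G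
stable⇒∣∣≤α {n} G S st =
  lookup (f[xs]≤f[argmax] ∅ (filter (stable? G) (subsets n)))
    (∈-filter⁺ (stable? G) (∈-subsets S) st)

-- In a broom of length ℓ, path i is the path vertex vᵢ (0 ≤ i ≤ ℓ), and the
-- added vertices leaf j are attached to v_ℓ = path (fromℕ ℓ).

data BroomVertex (ℓ m : ℕ) : Set where
  path : Fin (suc ℓ) → BroomVertex ℓ m
  leaf : Fin m → BroomVertex ℓ m

BroomAdj : ∀ {ℓ m} → Rel (BroomVertex ℓ m) 0ℓ
BroomAdj     (path i) (path j) = toℕ j ≡ suc (toℕ i) ⊎ toℕ i ≡ suc (toℕ j)
BroomAdj {ℓ} (path i) (leaf _) = i ≡ fromℕ ℓ
BroomAdj {ℓ} (leaf _) (path j) = j ≡ fromℕ ℓ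
BroomAdj     (leaf _) (leaf _) = ⊥

broom : ∀ ℓ m → Graph (BroomVertex ℓ m)
broom ℓ m = record { Adj = BroomAdj ; adj? = dec ; symm = λ {u} {v} → sy u v ; irrefl = λ {v} → irr v }
  where
  dec : Decidable (BroomAdj {ℓ} {m})
  dec (path i) (path j) = (toℕ j ℕ.≟ suc (toℕ i)) ⊎-dec (toℕ i ℕ.≟ suc (toℕ j))
  dec (path i) (leaf _) = i ≟ fromℕ ℓ
  dec (leaf _) (path j) = j ≟ fromℕ ℓ
  dec (leaf _) (leaf _) = no λ ()

  sy : ∀ u v → BroomAdj {ℓ} {m} u v → BroomAdj v u
  sy (path _) (path _) = swap
  sy (path _) (leaf _) = λ e → e
  sy (leaf _) (path _) = λ e → e

  irr : ∀ v → ¬ BroomAdj {ℓ} {m} v v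
  irr (path i) (inj₁ e) = ℕ.1+n≢n (sym e)
  irr (path i) (inj₂ e) = ℕ.1+n≢n (sym e)

root : ∀ {ℓ m} → BroomVertex ℓ m
root = path zero

-- The graph obtained from the disjoint union of the graphs B i by identifying
-- the vertices r i: its vertices are the common root ∙ and the non-root
-- vertices of each B i.

module _ {n : ℕ} {V : Fin n → Set} (r : ∀ i → V i) where

  data Identified : Set where
    ∙     : Identified
    other : ∀ i (v : V i) → .(v ≢ r i) → Identified

module _ {n : ℕ} {V : Fin n → Set} (B : ∀ i → Graph (V i)) (r : ∀ i → V i) where

  data IdentifiedAdj : Rel (Identified r) 0ℓ where
    root-other  : ∀ {i v} .{v≢r : v ≢ r i} →
                  Adj (B i) (r i) v → IdentifiedAdj ∙ (other i v v≢r)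
    other-root  : ∀ {i v} .{v≢r : v ≢ r i} →
                  Adj (B i) v (r i) → IdentifiedAdj (other i v v≢r) ∙
    other-other : ∀ {i u v} .{u≢r : u ≢ r i} .{v≢r : v ≢ r i} →
                  Adj (B i) u v → IdentifiedAdj (other i u u≢r) (other i v v≢r)

  identifyRoots : Graph (Identified r)
  identifyRoots = record { Adj = IdentifiedAdj ; adj? = dec ; symm = sy ; irrefl = irr }
    where
    dec : Decidable IdentifiedAdj
    dec ∙ ∙ = no λ ()
    dec ∙ (other i v _) with adj? (B i) (r i) v
    ... | yes a = yes (root-other a)
    ... | no ¬a = no λ { (root-other a) → ¬a a }
    dec (other i v _) ∙ with adj? (B i) v (r i)
    ... | yes a = yes (other-root a)
    ... | no ¬a = no λ { (other-root a) → ¬a a }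
    dec (other i u _) (other j v _) with i ≟ j
    ... | no i≢j = no λ { (other-other _) → i≢j refl }
    ... | yes refl with adj? (B i) u v
    ...   | yes a = yes (other-other a)
    ...   | no ¬a = no λ { (other-other a) → ¬a a }

    sy : Symmetric IdentifiedAdj
    sy (root-other a)          = other-root (symm (B _) a)
    sy (other-root a)          = root-other (symm (B _) a)
    sy (other-other {i = i} a) = other-other (symm (B i) a)

    irr : ∀ {v} → ¬ IdentifiedAdj v v
    irr (other-other {i = i} a) = irrefl (B i) a

-- The number n of brooms may be zero, giving the one-vertex graph.

IsMultibroom : ∀ {V : Set} → Graph V → Set
IsMultibroom T =
  ∃[ n ] Σ (Fin n → ℕ) λ ℓ → Σ (Fin n → ℕ) λ m →
    (∀ i → 1 ≤ ℓ i) ×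
    T ≅ identifyRoots (λ i → broom (ℓ i) (m i)) (λ i → root)

{-# OPTIONS --safe #-}
-- Call C expanding if |N_C[S]| > N |S| for every nonempty stable S ⊆ C. A set X in which every
-- stable set has size less than |X| / N contains an expanding C, because a stable S with
-- |N_C[S]| ≤ N |S| can be split off together with its closed neighbourhood. By induction on the
-- clique number, subsets of neighbourhoods contain stable subsets of proportional size.
--
-- In an expanding C take a vertex r whose ball has maximum size Δ and a large stable set A of
-- neighbours of r; then Y₀ = N_C[A] ∖ N_C[r] is much larger than Δ. The brooms are found greedily
-- below A, one at a time, each by a level search: if the next level W has a large stable subset,
-- this subset expands to a further level; otherwise W contains an expanding set, in which the
-- search restarts. To keep A from being exhausted, give every y ∈ Y₀ a parent in A and forbid the
-- heavy vertices, those near the parents of a constant fraction of Y₀: by double counting there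
-- are only O(Δ) of them.

module Submission where

open import Defs
import Algebra.Properties.CommutativeMonoid.Sum as CommutativeMonoidSum
open import Algebra.Properties.Semiring.Sum using (*-distribˡ-sum)
open import Data.Bool.Base using (Bool; true; false)
open import Data.Empty using (⊥; ⊥-elim; ⊥-elim-irr)
open import Data.Fin using (Fin; zero; suc)
open import Data.Fin.Properties using (_≟_; any?; suc-injective)
open import Data.Fin.Subset
  using (Subset; _∈_; _∉_; _⊆_; ∣_∣; _∪_; _─_; ⁅_⁆; Nonempty; inside; outside) renaming (⊥ to ∅; ⊤ to full)
open import Data.Fin.Subset.Properties
open import Data.Integer as ℤ using (+_)
import Data.Integer.Properties as ℤ
open import Data.List.Base as List using (List; []; _∷_; _++_; length; filter; allFin)
open import Data.List.Extrema.Nat using (argmax; argmax-all; f[xs]≤f[argmax])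
open import Data.List.Membership.Propositional using () renaming (_∈_ to _∈ˡ_)
open import Data.List.Membership.Propositional.Properties
  using (∈-++⁺ˡ; ∈-++⁺ʳ; ∈-filter⁺; ∈-allFin; ∈-tabulate⁺)
open import Data.List.Properties using (length-++; length-tabulate)
open import Data.List.Relation.Unary.All as All using (All; []; _∷_)
import Data.List.Relation.Unary.All.Properties as All
open import Data.List.Relation.Unary.Any as Any using (Any; here; there)
open import Data.Nat as ℕ using (ℕ; zero; suc; _+_; _*_; _≤_; _<_; z≤n; s≤s)
import Data.Nat.Properties as ℕ
open import Data.Nat.Tactic.RingSolver using (solve-∀)
open import Data.Product using (Σ; ∃-syntax; _×_; _,_; proj₁; proj₂)
open import Data.Rational as ℚ using (ℚ; 0ℚ; _/_)
import Data.Rational.Properties as ℚ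
open import Data.Rational.Unnormalised as ℚᵘ using (mkℚᵘ; *≤*)
import Data.Rational.Unnormalised.Properties as ℚᵘ
open import Data.Sum using (_⊎_; inj₁; inj₂; [_,_]′)
open import Data.Vec using ([]; _∷_; tabulate; here; there)
open import Data.Vec.Properties using ([]=⇒lookup; lookup⇒[]=; lookup∘tabulate)
open import Data.Vec.Properties.WithK using ([]=-irrelevant)
open import Function using (_∘_)
open import Function.Bundles using (mk⇔; mk↔ₛ′; Equivalence; Inverse)
open import Level using (0ℓ)
open import Relation.Binary.PropositionalEquality using (_≡_; _≢_; refl; sym; trans; cong; cong₂; subst; subst₂)
open import Relation.Nullary using (¬_; Dec; yes; no; does; ¬?)
open import Relation.Nullary.Decidable using (_×-dec_; _⊎-dec_; dec-true)
open import Relation.Unary using (Pred; Decidable)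

module Sum = CommutativeMonoidSum ℕ.+-0-commutativeMonoid
open Sum using (sum)

private variable n : ℕ

-- Subsets of `Fin n` and their sizes

⟨_⟩ : {P : Pred (Fin n) 0ℓ} → Decidable P → Subset n
⟨ P? ⟩ = tabulate (does ∘ P?)

module _ {P : Pred (Fin n) 0ℓ} (P? : Decidable P) {x : Fin n} where

  ∈⟨⟩⁺ : P x → x ∈ ⟨ P? ⟩
  ∈⟨⟩⁺ px = lookup⇒[]= x _ (trans (lookup∘tabulate (does ∘ P?) x) (dec-true (P? x) px))

  ∈⟨⟩⁻ : x ∈ ⟨ P? ⟩ → P x
  ∈⟨⟩⁻ x∈ with P? x | trans (sym (lookup∘tabulate (does ∘ P?) x)) ([]=⇒lookup x∈)
  ... | yes px | _ = px

∣∪∣≤ : (p q : Subset n) → ∣ p ∪ q ∣ ≤ ∣ p ∣ + ∣ q ∣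
∣∪∣≤ [] [] = z≤n
∣∪∣≤ (outside ∷ p) (outside ∷ q) = ∣∪∣≤ p q
∣∪∣≤ (outside ∷ p) (inside ∷ q) = ℕ.≤-trans (s≤s (∣∪∣≤ p q)) (ℕ.≤-reflexive (sym (ℕ.+-suc ∣ p ∣ ∣ q ∣)))
∣∪∣≤ (inside ∷ p) (outside ∷ q) = s≤s (∣∪∣≤ p q)
∣∪∣≤ (inside ∷ p) (inside ∷ q) = s≤s (ℕ.≤-trans (∣∪∣≤ p q) (ℕ.+-monoʳ-≤ ∣ p ∣ (ℕ.n≤1+n ∣ q ∣)))

∣∣-cover : (p q r : Subset n) → (∀ {x} → x ∈ p → x ∈ q ⊎ x ∈ r) → ∣ p ∣ ≤ ∣ q ∣ + ∣ r ∣
∣∣-cover p q r c = ℕ.≤-trans (p⊆q⇒∣p∣≤∣q∣ (x∈p∪q⁺ ∘ c)) (∣∪∣≤ q r)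

∣∪∣-disjoint : (p q : Subset n) → (∀ {x} → x ∈ p → x ∉ q) → ∣ p ∣ + ∣ q ∣ ≡ ∣ p ∪ q ∣
∣∪∣-disjoint [] [] d = refl
∣∪∣-disjoint (outside ∷ p) (outside ∷ q) d = ∣∪∣-disjoint p q (λ x y → d (there x) (there y))
∣∪∣-disjoint (outside ∷ p) (inside ∷ q) d =
  trans (ℕ.+-suc ∣ p ∣ ∣ q ∣) (cong suc (∣∪∣-disjoint p q (λ x y → d (there x) (there y))))
∣∪∣-disjoint (inside ∷ p) (outside ∷ q) d = cong suc (∣∪∣-disjoint p q (λ x y → d (there x) (there y)))
∣∪∣-disjoint (inside ∷ p) (inside ∷ q) d = ⊥-elim (d here here)

∈─⁻ : ∀ (p q : Subset n) {x} → x ∈ p ─ q → x ∈ p × x ∉ q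
∈─⁻ p q x∈ = p─q⊆p p q x∈ , disjoint p q x∈
  where
  disjoint : ∀ {n} (p q : Subset n) {x} → x ∈ p ─ q → x ∉ q
  disjoint (_ ∷ p) (inside ∷ q) () here
  disjoint (_ ∷ p) (inside ∷ q) (there a) (there b) = disjoint p q a b
  disjoint (_ ∷ p) (outside ∷ q) (there a) (there b) = disjoint p q a b

∣∣≤∣─∣+∣∣ : (p q : Subset n) → ∣ p ∣ ≤ ∣ p ─ q ∣ + ∣ q ∣
∣∣≤∣─∣+∣∣ p q = ∣∣-cover p (p ─ q) q split
  where
  split : ∀ {x} → x ∈ p → x ∈ p ─ q ⊎ x ∈ q
  split {x} x∈ with x ∈? q
  ... | yes x∈q = inj₂ x∈q
  ... | no  x∉q = inj₁ (x∈p∧x∉q⇒x∈p─q x∈ x∉q)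

empty⇒∣∣≡0 : (p : Subset n) → (∀ x → x ∉ p) → ∣ p ∣ ≡ 0
empty⇒∣∣≡0 {n} p e = trans (cong ∣_∣ (Empty-unique (λ (x , x∈) → e x x∈))) (∣⊥∣≡0 n)

nonempty⇒∣∣>0 : {p : Subset n} {x : Fin n} → x ∈ p → 0 < ∣ p ∣
nonempty⇒∣∣>0 {p = p} {x} x∈ = ℕ.≤-<-trans z≤n (x∈p⇒∣p-x∣<∣p∣ x∈)

∣∣>0⇒nonempty : (p : Subset n) → 0 < ∣ p ∣ → Nonempty p
∣∣>0⇒nonempty p 0<p with nonempty? p
... | yes ne = ne
... | no ¬ne = ⊥-elim (ℕ.<-irrefl (sym (empty⇒∣∣≡0 p (λ x x∈ → ¬ne (x , x∈)))) 0<p)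

enumerate : (p : Subset n) {k : ℕ} → k ≤ ∣ p ∣ →
            Σ (Fin k → Fin n) λ f → (∀ i → f i ∈ p) × (∀ {i j} → f i ≡ f j → i ≡ j)
enumerate p {zero} _ = (λ ()) , (λ ()) , λ {}
enumerate (outside ∷ p) {suc k} k≤p with enumerate p k≤p
... | f , f∈ , inj = suc ∘ f , there ∘ f∈ , λ e → inj (suc-injective e)
enumerate (inside ∷ p) {suc k} (s≤s k≤p) with enumerate p k≤p
... | f , f∈ , inj = g , g∈ , g-inj
  where
  g : Fin (suc k) → Fin _
  g zero = zero
  g (suc i) = suc (f i)
  g∈ : ∀ i → g i ∈ inside ∷ p
  g∈ zero = here
  g∈ (suc i) = there (f∈ i)
  g-inj : ∀ {i j} → g i ≡ g j → i ≡ j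
  g-inj {zero} {zero} _ = refl
  g-inj {suc i} {suc j} e = cong suc (inj (suc-injective e))

-- Counting

ind : Bool → ℕ
ind true  = 1
ind false = 0

∣tabulate∣ : (f : Fin n → Bool) → ∣ tabulate f ∣ ≡ sum (ind ∘ f)
∣tabulate∣ {zero} f = refl
∣tabulate∣ {suc n} f with f zero
... | true  = cong suc (∣tabulate∣ (f ∘ suc))
... | false = ∣tabulate∣ (f ∘ suc)

sum-mono : {f g : Fin n → ℕ} → (∀ i → f i ≤ g i) → sum f ≤ sum g
sum-mono {zero}  _   = z≤n
sum-mono {suc n} f≤g = ℕ.+-mono-≤ (f≤g zero) (sum-mono (f≤g ∘ suc))

∣∣≡sum : (p : Subset n) → ∣ p ∣ ≡ sum (λ x → ind (does (x ∈? p)))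
∣∣≡sum p = trans (ℕ.≤-antisym (p⊆q⇒∣p∣≤∣q∣ (∈⟨⟩⁺ (_∈? p))) (p⊆q⇒∣p∣≤∣q∣ (∈⟨⟩⁻ (_∈? p))))
                 (∣tabulate∣ (does ∘ (_∈? p)))

∣∣*≤sum : (p : Subset n) (s : ℕ) (g : Fin n → ℕ) → (∀ x → x ∈ p → s ≤ g x) → ∣ p ∣ * s ≤ sum g
∣∣*≤sum p s g h = begin
  ∣ p ∣ * s                                ≡⟨ ℕ.*-comm ∣ p ∣ s ⟩
  s * ∣ p ∣                                ≡⟨ cong (s *_) (∣∣≡sum p) ⟩
  s * sum (λ x → ind (does (x ∈? p)))     ≡⟨ *-distribˡ-sum ℕ.+-*-semiring s (λ x → ind (does (x ∈? p))) ⟩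
  sum (λ x → s * ind (does (x ∈? p)))     ≤⟨ sum-mono pointwise ⟩
  sum g                                   ∎
  where
  open ℕ.≤-Reasoning
  pointwise : ∀ x → s * ind (does (x ∈? p)) ≤ g x
  pointwise x with x ∈? p
  ... | yes x∈ = ℕ.≤-trans (ℕ.≤-reflexive (ℕ.*-identityʳ s)) (h x x∈)
  ... | no  _  = ℕ.≤-trans (ℕ.≤-reflexive (ℕ.*-zeroʳ s)) z≤n

sum≤∣∣* : (p : Subset n) (s : ℕ) (g : Fin n → ℕ) →
          (∀ x → x ∈ p → g x ≤ s) → (∀ x → x ∉ p → g x ≡ 0) → sum g ≤ ∣ p ∣ * s
sum≤∣∣* p s g h h₀ = begin
  sum g                                   ≤⟨ sum-mono pointwise ⟩
  sum (λ x → s * ind (does (x ∈? p)))     ≡⟨ sym (*-distribˡ-sum ℕ.+-*-semiring s (λ x → ind (does (x ∈? p)))) ⟩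
  s * sum (λ x → ind (does (x ∈? p)))     ≡⟨ cong (s *_) (sym (∣∣≡sum p)) ⟩
  s * ∣ p ∣                                ≡⟨ ℕ.*-comm s ∣ p ∣ ⟩
  ∣ p ∣ * s                                ∎
  where
  open ℕ.≤-Reasoning
  pointwise : ∀ x → g x ≤ s * ind (does (x ∈? p))
  pointwise x with x ∈? p
  ... | yes x∈ = ℕ.≤-trans (h x x∈) (ℕ.≤-reflexive (sym (ℕ.*-identityʳ s)))
  ... | no x∉  = ℕ.≤-trans (ℕ.≤-reflexive (h₀ x x∉)) z≤n

module _ {R : Fin n → Fin n → Set} (R? : ∀ x y → Dec (R x y)) where

  succs preds : Subset n → Fin n → Subset n
  succs q x = ⟨ (λ y → (y ∈? q) ×-dec R? x y) ⟩
  preds p y = ⟨ (λ x → (x ∈? p) ×-dec R? x y) ⟩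

  ∈succs⁺ : ∀ {q x y} → y ∈ q → R x y → y ∈ succs q x
  ∈succs⁺ {q} {x} y∈ r = ∈⟨⟩⁺ (λ y → (y ∈? q) ×-dec R? x y) (y∈ , r)

  ∈succs⁻ : ∀ {q x y} → y ∈ succs q x → y ∈ q × R x y
  ∈succs⁻ {q} {x} = ∈⟨⟩⁻ (λ y → (y ∈? q) ×-dec R? x y)

  -- Counting the pairs of `R` between `p` and `q` by rows and by columns. The factor `J` lets a row
  -- bound that is a fraction of `s` be stated without division.
  double-count : (p q : Subset n) (J s d : ℕ) →
    (∀ x → x ∈ p → s ≤ J * ∣ succs q x ∣) →
    (∀ y → y ∈ q → ∣ preds p y ∣ ≤ d) →
    ∣ p ∣ * s ≤ J * (∣ q ∣ * d)
  double-count p q J s d lo hi = begin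
    ∣ p ∣ * s                   ≤⟨ ∣∣*≤sum p s _ lo′ ⟩
    sum (λ x → J * ∣ row x ∣)   ≡⟨ sym (*-distribˡ-sum ℕ.+-*-semiring J (λ x → ∣ row x ∣)) ⟩
    J * sum (λ x → ∣ row x ∣)   ≡⟨ cong (J *_) rows≡cols ⟩
    J * sum (λ y → ∣ col y ∣)   ≤⟨ ℕ.*-monoʳ-≤ J (sum≤∣∣* q d _ hi′ empty) ⟩
    J * (∣ q ∣ * d)             ∎
    where
    open ℕ.≤-Reasoning
    -- Both memberships are built into the relation, so that the sums run over all of `Fin n` and
    -- can be interchanged.
    edge? : ∀ x y → Dec (x ∈ p × y ∈ q × R x y)
    edge? x y = (x ∈? p) ×-dec ((y ∈? q) ×-dec R? x y)
    row col : Fin n → Subset n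
    row x = ⟨ (λ y → edge? x y) ⟩
    col y = ⟨ (λ x → edge? x y) ⟩
    rows≡cols : sum (λ x → ∣ row x ∣) ≡ sum (λ y → ∣ col y ∣)
    rows≡cols = trans (Sum.sum-cong-≗ (λ x → ∣tabulate∣ (does ∘ edge? x)))
               (trans (Sum.∑-comm (λ x y → ind (does (edge? x y))))
                      (Sum.sum-cong-≗ (λ y → sym (∣tabulate∣ (λ x → does (edge? x y))))))
    lo′ : ∀ x → x ∈ p → s ≤ J * ∣ row x ∣
    lo′ x x∈ = ℕ.≤-trans (lo x x∈) (ℕ.*-monoʳ-≤ J (p⊆q⇒∣p∣≤∣q∣ λ y∈ →
      ∈⟨⟩⁺ (edge? x) (x∈ , ∈succs⁻ y∈)))
    hi′ : ∀ y → y ∈ q → ∣ col y ∣ ≤ d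
    hi′ y y∈ = ℕ.≤-trans (p⊆q⇒∣p∣≤∣q∣ λ x∈ →
      let x∈p , _ , r = ∈⟨⟩⁻ (λ x → edge? x y) x∈ in ∈⟨⟩⁺ (λ x → (x ∈? p) ×-dec R? x y) (x∈p , r))
      (hi y y∈)
    empty : ∀ y → y ∉ q → ∣ col y ∣ ≡ 0
    empty y y∉ = empty⇒∣∣≡0 (col y) λ x x∈ → y∉ (proj₁ (proj₂ (∈⟨⟩⁻ (λ x → edge? x y) x∈)))

  succsOf : Subset n → List (Fin n) → Subset n
  succsOf q xs = ⟨ (λ y → (y ∈? q) ×-dec Any.any? (λ x → R? x y) xs) ⟩

  ∈succsOf⁺ : ∀ {q xs y} → y ∈ q → Any (λ x → R x y) xs → y ∈ succsOf q xs
  ∈succsOf⁺ {q} {xs} y∈ r = ∈⟨⟩⁺ (λ y → (y ∈? q) ×-dec Any.any? (λ x → R? x y) xs) (y∈ , r)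

  ∈succsOf⁻ : ∀ {q xs y} → y ∈ succsOf q xs → y ∈ q × Any (λ x → R x y) xs
  ∈succsOf⁻ {q} {xs} = ∈⟨⟩⁻ (λ y → (y ∈? q) ×-dec Any.any? (λ x → R? x y) xs)

  -- Subadditivity, scaled by `K` so that each set may be bounded by a fraction of `d`.
  union-bound : (q : Subset n) (K d : ℕ) (xs : List (Fin n)) →
    All (λ x → K * ∣ succs q x ∣ ≤ d) xs → K * ∣ succsOf q xs ∣ ≤ length xs * d
  union-bound q K d [] [] = ℕ.≤-reflexive (trans (cong (K *_) (empty⇒∣∣≡0 (succsOf q []) none)) (ℕ.*-zeroʳ K))
    where
    none : ∀ y → y ∉ succsOf q []
    none y y∈ with () ← proj₂ (∈succsOf⁻ {q} {[]} y∈)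
  union-bound q K d (x ∷ xs) (b ∷ bs) = begin
    K * ∣ succsOf q (x ∷ xs) ∣                ≤⟨ ℕ.*-monoʳ-≤ K (∣∣-cover _ (succs q x) (succsOf q xs) split) ⟩
    K * (∣ succs q x ∣ + ∣ succsOf q xs ∣)    ≡⟨ ℕ.*-distribˡ-+ K ∣ succs q x ∣ _ ⟩
    K * ∣ succs q x ∣ + K * ∣ succsOf q xs ∣  ≤⟨ ℕ.+-mono-≤ b (union-bound q K d xs bs) ⟩
    d + length xs * d                         ∎
    where
    open ℕ.≤-Reasoning
    split : ∀ {y} → y ∈ succsOf q (x ∷ xs) → y ∈ succs q x ⊎ y ∈ succsOf q xs
    split y∈ with ∈succsOf⁻ {q} {x ∷ xs} y∈
    ... | y∈q , here r  = inj₁ (∈succs⁺ y∈q r)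
    ... | y∈q , there r = inj₂ (∈succsOf⁺ y∈q r)

-- Induced embeddings

record _↪_ {V : Set} (H : Graph V) {n : ℕ} (G : Graph (Fin n)) : Set where
  field
    to        : V → Fin n
    injective : ∀ {u v} → to u ≡ to v → u ≡ v
    adj⁺      : ∀ u v → Adj H u v → Adj G (to u) (to v)
    adj⁻      : ∀ u v → Adj G (to u) (to v) → Adj H u v

open _↪_

step-bounds : ∀ {θ N w b z} D → θ * 4 + D ≤ N → N * w < z + b → b ≤ 2 * (θ * w) → D * w < z × b < z
step-bounds {θ} {N} {w} {b} {z} D le lt b≤ =
  ℕ.+-cancelʳ-< b (D * w) z (begin-strict
    D * w + b             ≤⟨ ℕ.+-monoʳ-≤ (D * w) b≤ ⟩
    D * w + 2 * (θ * w)   ≤⟨ ℕ.m≤m+n _ (2 * (θ * w)) ⟩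
    D * w + 2 * (θ * w) + 2 * (θ * w) ≡⟨ e₁ D θ w ⟩
    (θ * 4 + D) * w       ≤⟨ ℕ.*-monoˡ-≤ w le ⟩
    N * w                 <⟨ lt ⟩
    z + b                 ∎) ,
  ℕ.+-cancelʳ-< b b z (begin-strict
    b + b                 ≤⟨ ℕ.+-mono-≤ b≤ b≤ ⟩
    2 * (θ * w) + 2 * (θ * w) ≤⟨ ℕ.m≤n+m _ (D * w) ⟩
    D * w + (2 * (θ * w) + 2 * (θ * w)) ≡⟨ e₂ D θ w ⟩
    (θ * 4 + D) * w       ≤⟨ ℕ.*-monoˡ-≤ w le ⟩
    N * w                 <⟨ lt ⟩
    z + b                 ∎)
  where
  open ℕ.≤-Reasoning
  e₁ : ∀ D θ w → D * w + 2 * (θ * w) + 2 * (θ * w) ≡ (θ * 4 + D) * w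
  e₁ = solve-∀
  e₂ : ∀ D θ w → D * w + (2 * (θ * w) + 2 * (θ * w)) ≡ (θ * 4 + D) * w
  e₂ = solve-∀

-- `threshold m k j` is the expansion that suffices to find a broom of length `j`. `restart m k j`
-- suffices for length `suc j` inside a fresh expanding set whose first level is part of a
-- neighbourhood; it is also the richness constant by which the two cases of the search are told
-- apart.
restart threshold : (m k j : ℕ) → ℕ
restart m k j = threshold m k j + (m * 4 + m * k)
threshold m k zero    = 0
threshold m k (suc j) = restart m k j + (restart m k j * 4 + m * k)

-- The threshold serves the search below `A`, one step down from the root. The other summands are
-- multiples of `∣ A ∣`: the first outweighs the forbidden vertices, `2 * (m * k)` makes the next
-- level large against `A`, and `suc m` pays for removing the ball of `r`.
demand : (m L ℓ k : ℕ) → ℕ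
demand m L ℓ k = threshold m k (ℕ.pred ℓ) + (4 * (4 * suc L + 1 + L) * suc m + 2 * (m * k) + suc m)

-- Neighbourhoods, rich sets and expanding sets

module _ {n : ℕ} (G : Graph (Fin n)) where

  Near : Fin n → Fin n → Set
  Near u v = u ≡ v ⊎ Adj G u v

  near? : ∀ u v → Dec (Near u v)
  near? u v = (u ≟ v) ⊎-dec adj? G u v

  near-sym : ∀ {u v} → Near u v → Near v u
  near-sym (inj₁ e) = inj₁ (sym e)
  near-sym (inj₂ a) = inj₂ (symm G a)

  N[_,_] : Subset n → Subset n → Subset n
  N[ C , S ] = ⟨ (λ v → (v ∈? C) ×-dec any? (λ s → (s ∈? S) ×-dec near? s v)) ⟩

  ∈N⁺ : ∀ {C S s v} → v ∈ C → s ∈ S → Near s v → v ∈ N[ C , S ]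
  ∈N⁺ {C} {S} v∈ s∈ r = ∈⟨⟩⁺ (λ v → (v ∈? C) ×-dec any? (λ s → (s ∈? S) ×-dec near? s v)) (v∈ , _ , s∈ , r)

  ∈N⁻ : ∀ {C S v} → v ∈ N[ C , S ] → v ∈ C × ∃[ s ] (s ∈ S × Near s v)
  ∈N⁻ {C} {S} = ∈⟨⟩⁻ (λ v → (v ∈? C) ×-dec any? (λ s → (s ∈? S) ×-dec near? s v))

  neighbours : Subset n → Fin n → Subset n
  neighbours = succs (adj? G)

  ∈neighbours⁺ : ∀ {C v u} → u ∈ C → Adj G v u → u ∈ neighbours C v
  ∈neighbours⁺ = ∈succs⁺ (adj? G)

  ∈neighbours⁻ : ∀ {C v u} → u ∈ neighbours C v → u ∈ C × Adj G v u
  ∈neighbours⁻ = ∈succs⁻ (adj? G)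

  ball : Subset n → Fin n → Subset n
  ball = succs near?

  ∈ball⁺ : ∀ {C u v} → v ∈ C → Near u v → v ∈ ball C u
  ∈ball⁺ = ∈succs⁺ near?

  ∈ball⁻ : ∀ {C u v} → v ∈ ball C u → v ∈ C × Near u v
  ∈ball⁻ = ∈succs⁻ near?

  ∣ball∣≤ : ∀ C r → ∣ ball C r ∣ ≤ suc ∣ neighbours C r ∣
  ∣ball∣≤ C r = ℕ.≤-trans (∣∣-cover (ball C r) ⁅ r ⁆ (neighbours C r) split)
                          (ℕ.+-monoˡ-≤ _ (ℕ.≤-reflexive (∣⁅x⁆∣≡1 r)))
    where
    split : ∀ {v} → v ∈ ball C r → v ∈ ⁅ r ⁆ ⊎ v ∈ neighbours C r
    split v∈ with ∈ball⁻ v∈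
    ... | _   , inj₁ refl = inj₁ (x∈⁅x⁆ r)
    ... | v∈C , inj₂ a    = inj₂ (∈neighbours⁺ v∈C a)

  -- The parameter is an inverse proportion; this keeps the induction in ℕ until the rational
  -- constant is formed.
  Rich : ℕ → Subset n → Set
  Rich m Q = ∃[ S ] (S ⊆ Q × Stable G S × ∣ Q ∣ ≤ m * ∣ S ∣)

  Expanding : ℕ → Subset n → Set
  Expanding N C = ∀ S → S ⊆ C → Stable G S → Nonempty S → N * ∣ S ∣ < ∣ N[ C , S ] ∣

  -- This is what the induction on the clique number supplies. Arbitrary subsets `Q` of a
  -- neighbourhood are allowed because the search meets neighbourhoods only within smaller and
  -- smaller sets.
  NeighbourhoodsRich : ℕ → Subset n → Set
  NeighbourhoodsRich m X = ∀ {y} → y ∈ X → ∀ {Q} → Q ⊆ X → (∀ {x} → x ∈ Q → Adj G y x) → Rich m Q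

  -- A contracting stable `S` is split off together with `N[ C , S ]`. A stable set found in the
  -- remainder is disjoint from `S` and not adjacent to it, so the two bounds add up. The process
  -- stops when nothing is left or the remainder is expanding.
  rich-or-expanding : ∀ N C → Rich N C ⊎ ∃[ C′ ] (C′ ⊆ C × Nonempty C′ × Expanding N C′)
  -- The first argument of `go` bounds the size of the set and makes the recursion structural.
  rich-or-expanding N C = go ∣ C ∣ C ℕ.≤-refl
    where
    Outcome : Subset n → Set
    Outcome C = Rich N C ⊎ ∃[ C′ ] (C′ ⊆ C × Nonempty C′ × Expanding N C′)

    Contracts : Subset n → Subset n → Set
    Contracts C S = (S ⊆ C × Stable G S) × (Nonempty S × ∣ N[ C , S ] ∣ ≤ N * ∣ S ∣)

    contracts? : ∀ C S → Dec (Contracts C S)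
    contracts? C S = ((S ⊆? C) ×-dec stable? G S) ×-dec (nonempty? S ×-dec (∣ N[ C , S ] ∣ ℕ.≤? N * ∣ S ∣))

    go : ∀ b C → ∣ C ∣ ≤ b → Outcome C
    go b C C≤b with nonempty? C
    ... | no empty = inj₁ (∅ , ⊥-elim ∘ ∉⊥ , (λ _ u∈ → ⊥-elim (∉⊥ u∈)) ,
                           ℕ.≤-trans (ℕ.≤-reflexive (empty⇒∣∣≡0 C λ x x∈ → empty (x , x∈))) z≤n)
    go zero C C≤b | yes (_ , x∈) = ⊥-elim (ℕ.n≮0 (ℕ.<-≤-trans (nonempty⇒∣∣>0 x∈) C≤b))
    go (suc b) C C≤b | yes ne with anySubset? (contracts? C)
    ... | no none = inj₂ (C , (λ x → x) , ne , λ S S⊆C stable S≠∅ →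
                          ℕ.≰⇒> (λ le → none (S , (S⊆C , stable) , S≠∅ , le)))
    ... | yes (S , (S⊆C , stable) , (s , s∈) , le) with go b (C ─ N[ C , S ]) smaller
      where
      smaller : ∣ C ─ N[ C , S ] ∣ ≤ b
      smaller = ℕ.≤-pred (ℕ.≤-trans (p∩q≢∅⇒∣p─q∣<∣p∣ C N[ C , S ]
        (s , x∈p∩q⁺ (S⊆C s∈ , ∈N⁺ (S⊆C s∈) s∈ (inj₁ refl)))) C≤b)
    ...   | inj₂ (C′ , C′⊆ , ne′ , ex) = inj₂ (C′ , proj₁ ∘ ∈─⁻ C N[ C , S ] ∘ C′⊆ , ne′ , ex)
    ...   | inj₁ (S′ , S′⊆ , stable′ , le′) = inj₁ (S ∪ S′ , ∪⊆ , stable∪ , bound)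
      where
      R = C ─ N[ C , S ]
      far : ∀ {u v} → u ∈ S → v ∈ S′ → ¬ Near u v
      far u∈ v∈ r = let v∈C , v∉N = ∈─⁻ C N[ C , S ] (S′⊆ v∈) in v∉N (∈N⁺ v∈C u∈ r)
      ∪⊆ : S ∪ S′ ⊆ C
      ∪⊆ x∈ with x∈p∪q⁻ S S′ x∈
      ... | inj₁ a = S⊆C a
      ... | inj₂ a = proj₁ (∈─⁻ C N[ C , S ] (S′⊆ a))
      stable∪ : Stable G (S ∪ S′)
      stable∪ u u∈ v v∈ with x∈p∪q⁻ S S′ u∈ | x∈p∪q⁻ S S′ v∈
      ... | inj₁ a | inj₁ b = stable u a v b
      ... | inj₂ a | inj₂ b = stable′ u a v b
      ... | inj₁ a | inj₂ b = far a b ∘ inj₂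
      ... | inj₂ a | inj₁ b = far b a ∘ inj₂ ∘ symm G
      bound : ∣ C ∣ ≤ N * ∣ S ∪ S′ ∣
      bound = begin
        ∣ C ∣                       ≤⟨ ∣∣≤∣─∣+∣∣ C N[ C , S ] ⟩
        ∣ R ∣ + ∣ N[ C , S ] ∣       ≤⟨ ℕ.+-mono-≤ le′ le ⟩
        N * ∣ S′ ∣ + N * ∣ S ∣       ≡⟨ ℕ.+-comm (N * ∣ S′ ∣) _ ⟩
        N * ∣ S ∣ + N * ∣ S′ ∣       ≡⟨ sym (ℕ.*-distribˡ-+ N ∣ S ∣ ∣ S′ ∣) ⟩
        N * (∣ S ∣ + ∣ S′ ∣)         ≤⟨ ℕ.*-monoʳ-≤ N (ℕ.≤-reflexive (∣∪∣-disjoint S S′ λ a b → far a b (inj₁ refl))) ⟩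
        N * ∣ S ∪ S′ ∣              ∎
        where open ℕ.≤-Reasoning

  -- Brooms rooted at a given vertex

  -- The root is exempt from `P`: during the search it lies in the level above, possibly outside the
  -- set that contains the rest, and in the end it is common to all brooms.
  record BroomAt (ℓ k : ℕ) (y : Fin n) (P : Fin n → Set) : Set where
    field
      embedding : broom ℓ k ↪ G
      to-root   : to embedding root ≡ y
      to-other  : ∀ v → v ≢ root → P (to embedding v)

  open BroomAt

  weaken : ∀ {ℓ k y} {P Q : Fin n → Set} → (∀ {v} → P v → Q v) → BroomAt ℓ k y P → BroomAt ℓ k y Q
  weaken f b = record { embedding = embedding b ; to-root = to-root b ; to-other = λ v v≢ → f (to-other b v v≢) }

  -- Length zero, excluded in a multibroom, is the base from which `extend` builds longer brooms.
  star : ∀ k y {S} → Stable G S → (∀ {x} → x ∈ S → Adj G y x) → k ≤ ∣ S ∣ → BroomAt 0 k y (_∈ S)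
  star k y {S} stable adj k≤ with enumerate S k≤
  ... | g , g∈ , g-inj = record
    { embedding = record { to = f ; injective = inj ; adj⁺ = f⁺ ; adj⁻ = f⁻ }
    ; to-root = refl ; to-other = f-other }
    where
    f : BroomVertex 0 k → Fin n
    f (path _) = y
    f (leaf i) = g i
    inj : ∀ {u v} → f u ≡ f v → u ≡ v
    inj {path zero} {path zero} _ = refl
    inj {path zero} {leaf i} e = ⊥-elim (irrefl G (subst (Adj G y) (sym e) (adj (g∈ i))))
    inj {leaf i} {path zero} e = ⊥-elim (irrefl G (subst (Adj G y) e (adj (g∈ i))))
    inj {leaf i} {leaf j} e = cong leaf (g-inj e)
    f⁺ : ∀ u v → BroomAdj u v → Adj G (f u) (f v)
    f⁺ (path zero) (path zero) (inj₁ ())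
    f⁺ (path zero) (path zero) (inj₂ ())
    f⁺ (path zero) (leaf i) _ = adj (g∈ i)
    f⁺ (leaf i) (path zero) _ = symm G (adj (g∈ i))
    f⁻ : ∀ u v → Adj G (f u) (f v) → BroomAdj u v
    f⁻ (path zero) (path zero) a = ⊥-elim (irrefl G a)
    f⁻ (path zero) (leaf i) _ = refl
    f⁻ (leaf i) (path zero) _ = refl
    f⁻ (leaf i) (leaf j) a = stable _ (g∈ i) _ (g∈ j) a
    f-other : ∀ v → v ≢ root → f v ∈ S
    f-other (path zero) v≢ = ⊥-elim (v≢ refl)
    f-other (leaf i) _ = g∈ i

  -- The new root `y` is put in front of the old root `z`. The remaining vertices satisfy `P` and so
  -- are not near `y`, which leaves `yz` as the only new edge.
  extend : ∀ {ℓ k y z} {P Q : Fin n → Set} → Adj G y z → Q z →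
           (∀ {v} → P v → Q v × ¬ Near y v) → BroomAt ℓ k z P → BroomAt (suc ℓ) k y Q
  extend {ℓ} {k} {y} {z} {P} {Q} yz qz pq b = record
    { embedding = record { to = f ; injective = inj ; adj⁺ = f⁺ ; adj⁻ = f⁻ }
    ; to-root = refl ; to-other = f-other }
    where
    e = embedding b
    up : BroomVertex ℓ k → BroomVertex (suc ℓ) k
    up (path i) = path (suc i)
    up (leaf i) = leaf i
    f : BroomVertex (suc ℓ) k → Fin n
    f (path zero) = y
    f (path (suc i)) = to e (path i)
    f (leaf i) = to e (leaf i)
    apart : ∀ v → v ≢ root → ¬ Near y (to e v)
    apart v v≢ = proj₂ (pq (to-other b v v≢))
    y≢z : y ≢ z
    y≢z refl = irrefl G yz
    y≢ : ∀ v → y ≢ to e v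
    y≢ (path zero) eq = y≢z (trans eq (to-root b))
    y≢ (path (suc i)) eq = apart (path (suc i)) (λ ()) (inj₁ eq)
    y≢ (leaf i) eq = apart (leaf i) (λ ()) (inj₁ eq)
    inj : ∀ {u v} → f u ≡ f v → u ≡ v
    inj {path zero} {path zero} _ = refl
    inj {path zero} {path (suc i)} eq = ⊥-elim (y≢ (path i) eq)
    inj {path zero} {leaf i} eq = ⊥-elim (y≢ (leaf i) eq)
    inj {path (suc i)} {path zero} eq = ⊥-elim (y≢ (path i) (sym eq))
    inj {leaf i} {path zero} eq = ⊥-elim (y≢ (leaf i) (sym eq))
    inj {path (suc i)} {path (suc j)} eq = cong up (injective e eq)
    inj {path (suc i)} {leaf j} eq = cong up (injective e eq)
    inj {leaf i} {path (suc j)} eq = cong up (injective e eq)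
    inj {leaf i} {leaf j} eq = cong up (injective e eq)
    yz′ : Adj G y (to e root)
    yz′ = subst (Adj G y) (sym (to-root b)) yz
    f⁺ : ∀ u v → BroomAdj u v → Adj G (f u) (f v)
    f⁺ (path zero) (path zero) (inj₁ ())
    f⁺ (path zero) (path zero) (inj₂ ())
    f⁺ (path zero) (path (suc zero)) _ = yz′
    f⁺ (path zero) (path (suc (suc i))) (inj₁ ())
    f⁺ (path zero) (path (suc (suc i))) (inj₂ ())
    f⁺ (path (suc zero)) (path zero) _ = symm G yz′
    f⁺ (path (suc (suc i))) (path zero) (inj₁ ())
    f⁺ (path (suc (suc i))) (path zero) (inj₂ ())
    f⁺ (path (suc i)) (path (suc j)) (inj₁ eq) = adj⁺ e (path i) (path j) (inj₁ (ℕ.suc-injective eq))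
    f⁺ (path (suc i)) (path (suc j)) (inj₂ eq) = adj⁺ e (path i) (path j) (inj₂ (ℕ.suc-injective eq))
    f⁺ (path zero) (leaf i) ()
    f⁺ (path (suc i)) (leaf j) eq = adj⁺ e (path i) (leaf j) (suc-injective eq)
    f⁺ (leaf i) (path zero) ()
    f⁺ (leaf i) (path (suc j)) eq = adj⁺ e (leaf i) (path j) (suc-injective eq)
    up-adj : ∀ i j → BroomAdj {ℓ} {k} (path i) (path j) → BroomAdj {suc ℓ} {k} (path (suc i)) (path (suc j))
    up-adj i j (inj₁ eq) = inj₁ (cong suc eq)
    up-adj i j (inj₂ eq) = inj₂ (cong suc eq)
    f⁻ : ∀ u v → Adj G (f u) (f v) → BroomAdj u v
    f⁻ (path zero) (path zero) a = ⊥-elim (irrefl G a)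
    f⁻ (path zero) (path (suc zero)) _ = inj₁ refl
    f⁻ (path zero) (path (suc (suc i))) a = ⊥-elim (apart (path (suc i)) (λ ()) (inj₂ a))
    f⁻ (path (suc zero)) (path zero) _ = inj₂ refl
    f⁻ (path (suc (suc i))) (path zero) a = ⊥-elim (apart (path (suc i)) (λ ()) (inj₂ (symm G a)))
    f⁻ (path (suc i)) (path (suc j)) a = up-adj i j (adj⁻ e (path i) (path j) a)
    f⁻ (path zero) (leaf i) a = ⊥-elim (apart (leaf i) (λ ()) (inj₂ a))
    f⁻ (path (suc i)) (leaf j) a = cong suc (adj⁻ e (path i) (leaf j) a)
    f⁻ (leaf i) (path zero) a = ⊥-elim (apart (leaf i) (λ ()) (inj₂ (symm G a)))
    f⁻ (leaf i) (path (suc j)) a = cong suc (adj⁻ e (leaf i) (path j) a)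
    f⁻ (leaf i) (leaf j) a = adj⁻ e (leaf i) (leaf j) a
    f-other : ∀ v → v ≢ root → Q (f v)
    f-other (path zero) v≢ = ⊥-elim (v≢ refl)
    f-other (path (suc zero)) _ = subst Q (sym (to-root b)) qz
    f-other (path (suc (suc i))) _ = proj₁ (pq (to-other b (path (suc i)) (λ ())))
    f-other (leaf i) _ = proj₁ (pq (to-other b (leaf i) (λ ())))

  -- M is the current level of a search in C, W the next one; B holds the
  -- vertices of C that are no longer available.
  record Frontier (C M W B : Subset n) : Set where
    field
      W⊆C     : W ⊆ C
      W∉B     : ∀ {w} → w ∈ W → w ∉ B
      M∉W     : ∀ {y} → y ∈ M → y ∉ W
      covered : ∀ {w} → w ∈ W → ∃[ y ] (y ∈ M × Adj G y w)
      apart   : ∀ {y v} → y ∈ M → v ∈ C → v ∉ B → v ∉ W → ¬ Near y v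

  open Frontier

  -- Level search for a single broom

  module _ (X : Subset n) (m : ℕ) (nbrs-rich : NeighbourhoodsRich m X) (k : ℕ) where

    -- The bound on `∣ B ∣` lets the expansion of a large stable part of `W` outweigh everything
    -- forbidden so far; the bound on `∣ M ∣` serves the averaging at length zero.
    Reaches : ℕ → ℕ → Set
    Reaches j N = ∀ {C M W B} → C ⊆ X → M ⊆ X → Expanding N C → Frontier C M W B → Nonempty W →
      ∣ B ∣ ≤ ∣ W ∣ → (m * k) * ∣ M ∣ < ∣ W ∣ →
      ∃[ y ] (y ∈ M × BroomAt j k y (λ v → v ∈ C × v ∉ B))

    -- Since `M` covers `W`, some vertex of `M` has more than `m * k` neighbours in `W`. Richness
    -- gives more than `k` pairwise nonadjacent ones among them, which serve as leaves.
    reaches-zero : ∀ N → Reaches 0 N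
    reaches-zero N {C} {M} {W} {B} C⊆X M⊆X ex L ne _ lt
      with any? (λ y → (y ∈? M) ×-dec (m * k ℕ.<? ∣ neighbours W y ∣))
    ... | no none = ⊥-elim (ℕ.<⇒≱ lt (begin
        ∣ W ∣                   ≡⟨ sym (ℕ.*-identityʳ _) ⟩
        ∣ W ∣ * 1               ≤⟨ double-count adj?ᵒ W M 1 1 (m * k) lo hi ⟩
        1 * (∣ M ∣ * (m * k))   ≡⟨ trans (ℕ.*-identityˡ _) (ℕ.*-comm ∣ M ∣ _) ⟩
        (m * k) * ∣ M ∣         ∎))
      where
      open ℕ.≤-Reasoning
      adj?ᵒ : ∀ w y → Dec (Adj G y w)
      adj?ᵒ w y = adj? G y w
      lo : ∀ w → w ∈ W → 1 ≤ 1 * ∣ succs adj?ᵒ M w ∣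
      lo w w∈ = let y , y∈ , a = covered L w∈ in
        ℕ.≤-trans (nonempty⇒∣∣>0 (∈succs⁺ adj?ᵒ y∈ a)) (ℕ.≤-reflexive (sym (ℕ.*-identityˡ _)))
      hi : ∀ y → y ∈ M → ∣ preds adj?ᵒ W y ∣ ≤ m * k
      hi y y∈ = ℕ.≮⇒≥ (λ lt → none (y , y∈ , lt))
    ... | yes (y , y∈ , big) with nbrs-rich (M⊆X y∈) (C⊆X ∘ W⊆C L ∘ proj₁ ∘ ∈neighbours⁻) (proj₂ ∘ ∈neighbours⁻)
    ...   | S , S⊆ , stable , le = y , y∈ , weaken (λ v∈ → let w∈ = proj₁ (∈neighbours⁻ (S⊆ v∈)) in W⊆C L w∈ , W∉B L w∈)
            (star k y stable (proj₂ ∘ ∈neighbours⁻ ∘ S⊆) (ℕ.<⇒≤ (ℕ.*-cancelˡ-< m _ _ (ℕ.<-≤-trans big le))))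

    -- The stable part `W′` of `W` becomes the new level. Its neighbourhood, cleared of `W` and `B`,
    -- is still large enough for the induction hypothesis, which gives a broom at some `z` in `W′`;
    -- a vertex `y` of `M` that covers `z` becomes the root.
    step : ∀ {j N} θ → Reaches j N → θ * 4 + m * k ≤ N → ∀ {C M W B} → C ⊆ X → Expanding N C →
           Frontier C M W B → Nonempty W → ∣ B ∣ ≤ ∣ W ∣ → Rich θ W →
           ∃[ y ] (y ∈ M × BroomAt (suc j) k y (λ v → v ∈ C × v ∉ B))
    step {j} {N} θ IH N≥ {C} {M} {W} {B} C⊆X ex L (w , w∈) B≤W (W′ , W′⊆W , stable , W≤) = y , y∈M , b
      where
      B₂ = W ∪ B
      W₂ = N[ C , W′ ] ─ B₂
      0<W′ : 0 < ∣ W′ ∣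
      0<W′ = ℕ.*-cancelˡ-< θ 0 ∣ W′ ∣ (ℕ.<-≤-trans (ℕ.≤-<-trans (ℕ.≤-reflexive (ℕ.*-zeroʳ θ)) (nonempty⇒∣∣>0 w∈)) W≤)
      B₂≤ : ∣ B₂ ∣ ≤ 2 * (θ * ∣ W′ ∣)
      B₂≤ = begin
        ∣ B₂ ∣                            ≤⟨ ∣∪∣≤ W B ⟩
        ∣ W ∣ + ∣ B ∣                      ≤⟨ ℕ.+-monoʳ-≤ ∣ W ∣ B≤W ⟩
        ∣ W ∣ + ∣ W ∣                      ≤⟨ ℕ.+-mono-≤ W≤ W≤ ⟩
        θ * ∣ W′ ∣ + θ * ∣ W′ ∣            ≡⟨ cong (λ x → θ * ∣ W′ ∣ + x) (sym (ℕ.+-identityʳ _)) ⟩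
        2 * (θ * ∣ W′ ∣)                  ∎
        where open ℕ.≤-Reasoning
      bounds : (m * k) * ∣ W′ ∣ < ∣ W₂ ∣ × ∣ B₂ ∣ < ∣ W₂ ∣
      bounds = step-bounds {θ} (m * k) N≥
        (ℕ.<-≤-trans (ex W′ (W⊆C L ∘ W′⊆W) stable (∣∣>0⇒nonempty W′ 0<W′)) (∣∣≤∣─∣+∣∣ N[ C , W′ ] B₂)) B₂≤
      L₂ : Frontier C W′ W₂ B₂
      L₂ = record
        { W⊆C = proj₁ ∘ ∈N⁻ ∘ proj₁ ∘ ∈─⁻ N[ C , W′ ] B₂
        ; W∉B = proj₂ ∘ ∈─⁻ N[ C , W′ ] B₂
        ; M∉W = λ y∈ y∈W₂ → proj₂ (∈─⁻ N[ C , W′ ] B₂ y∈W₂) (x∈p∪q⁺ (inj₁ (W′⊆W y∈)))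
        ; covered = cov
        ; apart = λ y∈ v∈C v∉B v∉W r → v∉W (x∈p∧x∉q⇒x∈p─q (∈N⁺ v∈C y∈ r) v∉B) }
        where
        cov : ∀ {w} → w ∈ W₂ → ∃[ y ] (y ∈ W′ × Adj G y w)
        cov w∈ with ∈─⁻ N[ C , W′ ] B₂ w∈
        ... | w∈N , w∉B₂ with ∈N⁻ w∈N
        ... | _ , y , y∈ , inj₂ a = y , y∈ , a
        ... | _ , y , y∈ , inj₁ refl = ⊥-elim (w∉B₂ (x∈p∪q⁺ (inj₁ (W′⊆W y∈))))
      found : ∃[ z ] (z ∈ W′ × BroomAt j k z (λ v → v ∈ C × v ∉ B₂))
      found = IH C⊆X (C⊆X ∘ W⊆C L ∘ W′⊆W) ex L₂ (∣∣>0⇒nonempty W₂ (ℕ.≤-<-trans z≤n (proj₂ bounds)))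
                (ℕ.<⇒≤ (proj₂ bounds)) (proj₁ bounds)
      z = proj₁ found
      z∈W = W′⊆W (proj₁ (proj₂ found))
      y = proj₁ (covered L z∈W)
      y∈M = proj₁ (proj₂ (covered L z∈W))
      b : BroomAt (suc j) k y (λ v → v ∈ C × v ∉ B)
      -- Below `z` the broom avoids `W` as well as `B`, so `apart` keeps it away from `y`.
      b = extend (proj₂ (proj₂ (covered L z∈W))) (W⊆C L z∈W , W∉B L z∈W)
        (λ (v∈C , v∉B₂) → (v∈C , v∉B₂ ∘ x∈p∪q⁺ ∘ inj₂) ,
           apart L y∈M v∈C (v∉B₂ ∘ x∈p∪q⁺ ∘ inj₂) (v∉B₂ ∘ x∈p∪q⁺ ∘ inj₁))
        (proj₂ (proj₂ found))

    -- Neighbourhoods are rich even when W is not, so inside an expanding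
    -- C′ ⊆ W the search can restart from the neighbourhood of one vertex of M.
    step-within : ∀ {j N} → Reaches j N → m * 4 + m * k ≤ N → ∀ {C M W B C′} → C ⊆ X → M ⊆ X →
                  Frontier C M W B → C′ ⊆ W → Nonempty C′ → Expanding N C′ →
                  ∃[ y ] (y ∈ M × BroomAt (suc j) k y (λ v → v ∈ C × v ∉ B))
    step-within IH N≥ {C} {M} {W} {B} {C′} C⊆X M⊆X L C′⊆W (w , w∈C′) ex = u , u∈M ,
      weaken (λ (v∈C′ , _) → W⊆C L (C′⊆W v∈C′) , W∉B L (C′⊆W v∈C′)) (proj₂ (proj₂ found))
      where
      C′⊆X : C′ ⊆ X
      C′⊆X = C⊆X ∘ W⊆C L ∘ C′⊆W
      y : Fin n
      y = proj₁ (covered L (C′⊆W w∈C′))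
      y∈M : y ∈ M
      y∈M = proj₁ (proj₂ (covered L (C′⊆W w∈C′)))
      yw : Adj G y w
      yw = proj₂ (proj₂ (covered L (C′⊆W w∈C′)))
      y∉C′ : y ∉ C′
      y∉C′ = M∉W L y∈M ∘ C′⊆W
      -- As `y` is outside `C′`, a vertex of `C′` that is not its neighbour is not near it. Hence
      -- nothing has to be forbidden.
      L′ : Frontier C′ ⁅ y ⁆ (neighbours C′ y) ∅
      L′ = record
        { W⊆C     = proj₁ ∘ ∈neighbours⁻
        ; W∉B     = λ _ → ∉⊥
        ; M∉W     = λ u∈ u∈W → y∉C′ (subst (_∈ C′) (x∈⁅y⁆⇒x≡y y u∈) (proj₁ (∈neighbours⁻ u∈W)))
        ; covered = λ w∈ → y , x∈⁅x⁆ y , proj₂ (∈neighbours⁻ w∈)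
        ; apart   = λ u∈ v∈ _ v∉ near → far (subst (λ u → Near u _) (x∈⁅y⁆⇒x≡y y u∈) near) v∈ v∉ }
        where
        far : ∀ {v} → Near y v → v ∈ C′ → v ∉ neighbours C′ y → ⊥
        far (inj₁ y≡v) v∈ _  = y∉C′ (subst (_∈ C′) (sym y≡v) v∈)
        far (inj₂ a)   v∈ v∉ = v∉ (∈neighbours⁺ v∈ a)
      found : ∃[ u ] (u ∈ ⁅ y ⁆ × BroomAt (suc _) k u (λ v → v ∈ C′ × v ∉ ∅))
      -- The new level is part of a neighbourhood, hence rich with constant `m`, which is why `θ` is
      -- `m` here.
      found = step m IH N≥ C′⊆X ex L′ (w , ∈neighbours⁺ w∈C′ yw)
        (ℕ.≤-trans (ℕ.≤-reflexive (∣⊥∣≡0 n)) z≤n)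
        (nbrs-rich (M⊆X y∈M) (C′⊆X ∘ proj₁ ∘ ∈neighbours⁻) (proj₂ ∘ ∈neighbours⁻))
      u : Fin n
      u = proj₁ found
      u∈M : u ∈ M
      u∈M = subst (_∈ M) (sym (x∈⁅y⁆⇒x≡y y (proj₁ (proj₂ found)))) y∈M

    -- Induction on the length. If `W` is rich with constant `restart m k j`, the search goes one
    -- level down in the same `C`; otherwise it restarts in an expanding subset of `W`, where the
    -- expansion is only `restart m k j`.
    reaches : ∀ j N → threshold m k j ≤ N → Reaches j N
    reaches zero N _ = reaches-zero N
    reaches (suc j) N N≥ {W = W} C⊆X M⊆X ex L W≠∅ B≤W _ =
      [ step (restart m k j) (reaches j N N≥threshold) (ℕ.≤-trans (ℕ.m≤n+m _ (restart m k j)) N≥)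
          C⊆X ex L W≠∅ B≤W
      , (λ (C′ , C′⊆W , C′≠∅ , ex′) → step-within (reaches j (restart m k j) (ℕ.m≤m+n _ _))
          (ℕ.m≤n+m _ (threshold m k j)) C⊆X M⊆X L C′⊆W C′≠∅ ex′)
      ]′ (rich-or-expanding (restart m k j) W)
      where
      N≥threshold : threshold m k j ≤ N
      N≥threshold = ℕ.≤-trans (ℕ.≤-trans (ℕ.m≤m+n _ _) (ℕ.m≤m+n (restart m k j) _)) N≥

-- Induced copies, cliques and gluing at the root

module _ {n : ℕ} {G : Graph (Fin n)} where

  private
    Σ-≡ : ∀ {S : Subset n} {u v} {p : u ∈ S} {q : v ∈ S} → u ≡ v → (u , p) ≡ (v , q)
    Σ-≡ {u = u} {p = p} {q} refl = cong (u ,_) ([]=-irrelevant p q)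

  -- The image of the embedding is a decidable subset and induces a copy of `T`; the inverse map
  -- searches for preimages, which are unique by injectivity.
  ↪⇒¬free : ∀ {t} {T : Graph (Fin t)} → T ↪ G → ¬ (G IsFreeOf T)
  ↪⇒¬free {T = T} e free = free (S , record
    { bijection = mk↔ₛ′ index vertex
        (λ i → injective e (proj₂ (∈⟨⟩⁻ image? (proj₂ (vertex i)))))
        (λ (_ , p) → Σ-≡ (proj₂ (∈⟨⟩⁻ image? p)))
    ; preserves = λ u v → mk⇔
        (λ a → adj⁻ e _ _ (subst₂ (Adj G) (sym (index-eq u)) (sym (index-eq v)) a))
        (λ a → subst₂ (Adj G) (index-eq u) (index-eq v) (adj⁺ e _ _ a)) })
    where
    image? : Decidable (λ v → ∃[ i ] to e i ≡ v)
    image? v = any? (λ i → to e i ≟ v)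
    S = ⟨ image? ⟩
    index : (∃[ v ] v ∈ S) → Fin _
    index (_ , p) = proj₁ (∈⟨⟩⁻ image? p)
    vertex : Fin _ → ∃[ v ] v ∈ S
    vertex i = to e i , ∈⟨⟩⁺ image? (i , refl)
    index-eq : ∀ u → to e (index u) ≡ proj₁ u
    index-eq (_ , p) = proj₂ (∈⟨⟩⁻ image? p)

  ≅-↪ : ∀ {V W : Set} {H : Graph V} {K : Graph W} → H ≅ K → K ↪ G → H ↪ G
  ≅-↪ iso e = record
    { to        = to e ∘ Inverse.to bijection
    ; injective = λ eq → trans (sym (Inverse.strictlyInverseʳ bijection _))
                    (trans (cong (Inverse.from bijection) (injective e eq)) (Inverse.strictlyInverseʳ bijection _))
    ; adj⁺      = λ u v a → adj⁺ e _ _ (Equivalence.to (preserves u v) a)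
    ; adj⁻      = λ u v a → Equivalence.from (preserves u v) (adj⁻ e _ _ a) }
    where open _≅_ iso

  CliqueIn : ℕ → Subset n → Set
  CliqueIn k X = Σ (Fin k → Fin n) λ f → (∀ i → f i ∈ X) × (∀ {i j} → i ≢ j → Adj G (f i) (f j))

  clique⇒↪ : ∀ {k X} → CliqueIn k X → complete k ↪ G
  clique⇒↪ (f , _ , adj) = record { to = f ; injective = inj ; adj⁺ = λ _ _ → adj
    ; adj⁻ = λ { u .u a refl → irrefl G a } }
    where
    inj : ∀ {u v} → f u ≡ f v → u ≡ v
    inj {u} {v} eq with u ≟ v
    ... | yes u≡v = u≡v
    ... | no u≢v = ⊥-elim (irrefl G (subst (Adj G (f u)) (sym eq) (adj u≢v)))

  clique-suc : ∀ {k X Q y} → y ∈ X → Q ⊆ X → (∀ {x} → x ∈ Q → Adj G y x) → CliqueIn k Q → CliqueIn (suc k) X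
  clique-suc {k} {X} {Q} {y} y∈ Q⊆ adj (f , f∈ , f-adj) = g , g∈ , g-adj
    where
    g : Fin (suc k) → Fin n
    g zero = y
    g (suc i) = f i
    g∈ : ∀ i → g i ∈ X
    g∈ zero = y∈
    g∈ (suc i) = Q⊆ (f∈ i)
    g-adj : ∀ {i j} → i ≢ j → Adj G (g i) (g j)
    g-adj {zero} {zero} i≢j = ⊥-elim (i≢j refl)
    g-adj {zero} {suc j} _ = adj (f∈ j)
    g-adj {suc i} {zero} _ = symm G (adj (f∈ i))
    g-adj {suc i} {suc j} i≢j = f-adj (i≢j ∘ cong suc)

  -- Inside one broom its own embedding decides everything, including that no other vertex meets
  -- `r`. Between different brooms `cross` excludes both coincidences and edges.
  multibroom↪ : ∀ {s} {ℓ k : Fin s → ℕ} {r} (e : ∀ i → broom (ℓ i) (k i) ↪ G) → (∀ i → to (e i) root ≡ r) →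
    (∀ {i j} → i ≢ j → ∀ u v → u ≢ root → v ≢ root → ¬ Near G (to (e i) u) (to (e j) v)) →
    identifyRoots (λ i → broom (ℓ i) (k i)) (λ i → root) ↪ G
  multibroom↪ {s} {ℓ} {k} {r} e e-root cross = record { to = f ; injective = inj ; adj⁺ = f⁺ ; adj⁻ = f⁻ }
    where
    I = Identified {V = λ i → BroomVertex (ℓ i) (k i)} (λ i → root)
    IAdj = IdentifiedAdj (λ i → broom (ℓ i) (k i)) (λ i → root)
    f : I → Fin n
    f ∙ = r
    f (other i v _) = to (e i) v
    root-inj : ∀ i v → r ≡ to (e i) v → v ≡ root
    root-inj i v eq = injective (e i) (trans (sym eq) (sym (e-root i)))
    inj : ∀ {u v} → f u ≡ f v → u ≡ v
    inj {∙} {∙} _ = refl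
    -- The inequality stored in `other` is irrelevant, so the contradiction is eliminated
    -- irrelevantly.
    inj {∙} {other i v v≢} eq = ⊥-elim-irr (v≢ (root-inj i v eq))
    inj {other i v v≢} {∙} eq = ⊥-elim-irr (v≢ (root-inj i v (sym eq)))
    inj {other i u u≢} {other j v v≢} eq with i ≟ j
    ... | no i≢j = ⊥-elim-irr (cross i≢j u v u≢ v≢ (inj₁ eq))
    ... | yes refl with refl ← injective (e i) {u} {v} eq = refl
    f⁺ : ∀ u v → IAdj u v → Adj G (f u) (f v)
    f⁺ _ _ (root-other {i} {v} a) = subst (λ x → Adj G x (to (e i) v)) (e-root i) (adj⁺ (e i) root v a)
    f⁺ _ _ (other-root {i} {v} a) = subst (Adj G (to (e i) v)) (e-root i) (adj⁺ (e i) v root a)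
    f⁺ _ _ (other-other {i} {u} {v} a) = adj⁺ (e i) u v a
    f⁻ : ∀ u v → Adj G (f u) (f v) → IAdj u v
    f⁻ ∙ ∙ a = ⊥-elim (irrefl G a)
    f⁻ ∙ (other i v _) a = root-other (adj⁻ (e i) root v (subst (λ x → Adj G x (to (e i) v)) (sym (e-root i)) a))
    f⁻ (other i v _) ∙ a = other-root (adj⁻ (e i) v root (subst (Adj G (to (e i) v)) (sym (e-root i)) a))
    f⁻ (other i u u≢) (other j v v≢) a with i ≟ j
    ... | no i≢j = ⊥-elim-irr (cross i≢j u v u≢ v≢ (inj₂ a))
    ... | yes refl = other-other (adj⁻ (e i) u v a)

open BroomAt

-- Vertex lists of brooms, and a maximising vertex

module _ {n : ℕ} {G : Graph (Fin n)} {ℓ k : ℕ} {y : Fin n} {P : Fin n → Set} (b : BroomAt G ℓ k y P) where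

  paths : List (Fin n)
  paths = List.tabulate {n = ℓ} (λ i → to (embedding b) (path (suc i)))

  leaves : List (Fin n)
  leaves = List.tabulate {n = k} (λ i → to (embedding b) (leaf i))

  -- The root is left out, being shared by all brooms.
  vertices : List (Fin n)
  vertices = paths ++ leaves

  length-vertices : length vertices ≡ ℓ + k
  length-vertices = trans (length-++ paths) (cong₂ _+_ {length paths} {ℓ} (length-tabulate _) (length-tabulate _))

  vertices-all : All P vertices
  vertices-all = All.++⁺ (All.tabulate⁺ (λ i → to-other b (path (suc i)) λ ()))
                         (All.tabulate⁺ (λ i → to-other b (leaf i) λ ()))

  ∈-vertices : ∀ v → v ≢ root → to (embedding b) v ∈ˡ vertices
  ∈-vertices (path zero)    v≢ = ⊥-elim (v≢ refl)
  ∈-vertices (path (suc i)) _  = ∈-++⁺ˡ (∈-tabulate⁺ i)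
  ∈-vertices (leaf i)       _  = ∈-++⁺ʳ paths (∈-tabulate⁺ i)

maximiser : ∀ {n} (g : Fin n → ℕ) {C : Subset n} → Nonempty C → ∃[ r ] (r ∈ C × (∀ v → v ∈ C → g v ≤ g r))
maximiser {n} g {C} (c , c∈) =
  argmax g c xs , argmax-all g {P = _∈ C} c∈ (All.all-filter (_∈? C) (allFin n)) ,
  λ v v∈ → All.lookup (f[xs]≤f[argmax] {f = g} c xs) (∈-filter⁺ (_∈? C) (∈-allFin v) v∈)
  where xs = filter (_∈? C) (allFin n)

-- Greedy choice of the brooms at `r`

module _ {n : ℕ} (G : Graph (Fin n)) (X : Subset n) (m : ℕ) (nbrs-rich : NeighbourhoodsRich G m X) where

  module _ {C : Subset n} (C⊆X : C ⊆ X) (N : ℕ) (expanding : Expanding G N C) (L : ℕ)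
           {r : Fin n} (r-max : ∀ v → v ∈ C → ∣ ball G C v ∣ ≤ ∣ ball G C r ∣)
           {A : Subset n} (A⊆ : A ⊆ neighbours G C r) (A-stable : Stable G A)
           (A-rich : ∣ neighbours G C r ∣ ≤ m * ∣ A ∣) (0<A : 0 < ∣ A ∣) where

    -- A light vertex spoils at most a fraction `1 / K` of `Y₀`. As at most `L` vertices are ever
    -- used, they spoil at most a quarter together.
    Δ K : ℕ
    Δ = ∣ ball G C r ∣
    K = 4 * suc L

    A⊆C : A ⊆ C
    A⊆C = proj₁ ∘ ∈neighbours⁻ G ∘ A⊆

    -- Multiples of `Δ` can thus be charged to `∣ A ∣`, to which expansion applies. The extra one in
    -- `suc m` accounts for `r` itself.
    Δ≤ : Δ ≤ suc m * ∣ A ∣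
    Δ≤ = begin
      Δ                            ≤⟨ ∣ball∣≤ G C r ⟩
      suc ∣ neighbours G C r ∣     ≤⟨ ℕ.+-mono-≤ 0<A A-rich ⟩
      ∣ A ∣ + m * ∣ A ∣            ∎
      where open ℕ.≤-Reasoning

    N[A] Y₀ : Subset n
    N[A] = N[_,_] G C A
    Y₀ = N[A] ─ ball G C r

    parent : Fin n → Fin n
    parent y with any? (λ s → (s ∈? A) ×-dec near? G s y)
    ... | yes (s , _) = s
    -- A default value; it does not occur for `y` in `Y₀`.
    ... | no  _       = y

    parent-ok : ∀ {y} → y ∈ Y₀ → parent y ∈ A × Near G (parent y) y
    parent-ok {y} y∈ with any? (λ s → (s ∈? A) ×-dec near? G s y)
    ... | yes (_ , ok) = ok
    ... | no  none     = ⊥-elim (none (proj₂ (∈N⁻ G (proj₁ (∈─⁻ N[A] (ball G C r) y∈)))))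

    -- Once v is used, y cannot be reached through its parent any more.
    spoils? : ∀ v y → Dec (Near G (parent y) v)
    spoils? v y = near? G (parent y) v

    spoilt : Fin n → Subset n
    spoilt = succs spoils? Y₀

    heavy? : Decidable (λ v → v ∈ C × ∣ Y₀ ∣ < K * ∣ spoilt v ∣)
    heavy? v = (v ∈? C) ×-dec (∣ Y₀ ∣ ℕ.<? K * ∣ spoilt v ∣)

    heavy : Subset n
    heavy = ⟨ heavy? ⟩

    Light : Fin n → Set
    Light v = v ∈ C × v ∉ heavy

    light-bound : ∀ {v} → Light v → K * ∣ spoilt v ∣ ≤ ∣ Y₀ ∣
    light-bound (v∈ , v∉) = ℕ.≮⇒≥ (λ lt → v∉ (∈⟨⟩⁺ heavy? (v∈ , lt)))

    -- Each heavy vertex spoils more than `∣ Y₀ ∣ / K` vertices, while a vertex of `Y₀` is spoilt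
    -- only from the ball of its parent, which has size at most `Δ` by the choice of `r`. The factor
    -- `∣ Y₀ ∣` is cancelled later, once `Y₀` is known to be nonempty.
    heavy-bound : ∣ heavy ∣ * ∣ Y₀ ∣ ≤ (K * Δ) * ∣ Y₀ ∣
    heavy-bound = begin
      ∣ heavy ∣ * ∣ Y₀ ∣    ≤⟨ double-count spoils? heavy Y₀ K ∣ Y₀ ∣ Δ (λ v v∈ → ℕ.<⇒≤ (proj₂ (∈⟨⟩⁻ heavy? v∈))) hi ⟩
      K * (∣ Y₀ ∣ * Δ)      ≡⟨ e K ∣ Y₀ ∣ Δ ⟩
      (K * Δ) * ∣ Y₀ ∣      ∎
      where
      open ℕ.≤-Reasoning
      e : ∀ a b c → a * (b * c) ≡ a * c * b
      e = solve-∀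
      hi : ∀ y → y ∈ Y₀ → ∣ preds spoils? heavy y ∣ ≤ Δ
      hi y y∈ = ℕ.≤-trans (p⊆q⇒∣p∣≤∣q∣ sub) (r-max (parent y) (A⊆C (proj₁ (parent-ok y∈))))
        where
        sub : preds spoils? heavy y ⊆ ball G C (parent y)
        sub v∈ = let v∈h , nr = ∈⟨⟩⁻ (λ v → (v ∈? heavy) ×-dec spoils? v y) v∈
                 in ∈ball⁺ G (proj₁ (∈⟨⟩⁻ heavy? v∈h)) nr

    -- The search starts at `A′`, the part of `A` away from `U`, with next level `Y`. Forbidding
    -- `heavy` keeps the new broom light, `used` keeps it away from `U`, and the ball of `r` keeps
    -- `r` adjacent only to the first vertex. Removing `spent` ensures that `A′` still covers `Y`.
    next : ∀ ℓ k → 1 ≤ ℓ → demand m L ℓ k ≤ N → (U : List (Fin n)) → All Light U → length U ≤ L →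
           BroomAt G ℓ k r (λ v → Light v × ¬ Any (λ u → Near G u v) U)
    next (suc ℓ) k _ N≥ U U-light U≤L = broom-at
      where
      open ℕ.≤-Reasoning
      -- The summands account for `heavy`, the ball of `r` and `used`, in units of `Δ`.
      c = K + 1 + L
      Y₀-big : 4 * c * Δ + 2 * (m * k) * ∣ A ∣ < ∣ Y₀ ∣
      Y₀-big = ℕ.+-cancelʳ-< Δ _ _ (begin-strict
        4 * c * Δ + 2 * (m * k) * ∣ A ∣ + Δ
          ≤⟨ ℕ.+-mono-≤ (ℕ.+-monoˡ-≤ _ (ℕ.*-monoʳ-≤ (4 * c) Δ≤)) Δ≤ ⟩
        4 * c * (suc m * ∣ A ∣) + 2 * (m * k) * ∣ A ∣ + suc m * ∣ A ∣
          ≡⟨ e (4 * c) (suc m) (2 * (m * k)) ∣ A ∣ ⟩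
        (4 * c * suc m + 2 * (m * k) + suc m) * ∣ A ∣
          ≤⟨ ℕ.*-monoˡ-≤ ∣ A ∣ (ℕ.≤-trans (ℕ.m≤n+m _ (threshold m k ℓ)) N≥) ⟩
        N * ∣ A ∣           <⟨ expanding A A⊆C A-stable (∣∣>0⇒nonempty A 0<A) ⟩
        ∣ N[A] ∣    ≤⟨ ∣∣≤∣─∣+∣∣ N[A] (ball G C r) ⟩
        ∣ Y₀ ∣ + Δ          ∎)
        where
        e : ∀ a b d x → a * (b * x) + d * x + b * x ≡ (a * b + d + b) * x
        e = solve-∀
      spent used F B Y A′ : Subset n
      spent = succsOf spoils? Y₀ U
      used  = succsOf (near? G) C U
      F  = (heavy ∪ ball G C r) ∪ used
      B  = F ∪ spent
      Y  = Y₀ ─ B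
      far? : ∀ a → Dec (a ∈ A × ¬ Any (λ u → Near G a u) U)
      far? a = (a ∈? A) ×-dec ¬? (Any.any? (near? G a) U)
      A′ = ⟨ far? ⟩

      heavy≤ : ∣ heavy ∣ ≤ K * Δ
      heavy≤ = ℕ.*-cancelʳ-≤ (∣ heavy ∣) (K * Δ) (∣ Y₀ ∣) {{ℕ.>-nonZero (ℕ.≤-<-trans z≤n Y₀-big)}} heavy-bound
      used≤ : ∣ used ∣ ≤ L * Δ
      used≤ = begin
        ∣ used ∣        ≡⟨ sym (ℕ.*-identityˡ _) ⟩
        1 * ∣ used ∣    ≤⟨ union-bound (near? G) C 1 Δ U (All.map (λ (u∈ , _) →
                            ℕ.≤-trans (ℕ.≤-reflexive (ℕ.*-identityˡ _)) (r-max _ u∈)) U-light) ⟩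
        length U * Δ    ≤⟨ ℕ.*-monoˡ-≤ Δ U≤L ⟩
        L * Δ           ∎
      F≤ : ∣ F ∣ ≤ c * Δ
      F≤ = begin
        ∣ F ∣                            ≤⟨ ∣∪∣≤ (heavy ∪ ball G C r) used ⟩
        ∣ heavy ∪ ball G C r ∣ + ∣ used ∣    ≤⟨ ℕ.+-mono-≤ (∣∪∣≤ heavy (ball G C r)) used≤ ⟩
        ∣ heavy ∣ + Δ + L * Δ            ≤⟨ ℕ.+-monoˡ-≤ (L * Δ) (ℕ.+-monoˡ-≤ Δ heavy≤) ⟩
        K * Δ + Δ + L * Δ                ≡⟨ e K L Δ ⟩
        c * Δ                            ∎
        where
        e : ∀ a b d → a * d + d + b * d ≡ (a + 1 + b) * d
        e = solve-∀
      spent≤ : 4 * ∣ spent ∣ ≤ ∣ Y₀ ∣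
      -- With `suc L` in place of `L` the factor to be cancelled is positive.
      spent≤ = ℕ.*-cancelˡ-≤ (suc L) (begin
        suc L * (4 * ∣ spent ∣)   ≡⟨ e (suc L) ∣ spent ∣ ⟩
        K * ∣ spent ∣             ≤⟨ union-bound spoils? Y₀ K ∣ Y₀ ∣ U (All.map light-bound U-light) ⟩
        length U * ∣ Y₀ ∣         ≤⟨ ℕ.*-monoˡ-≤ ∣ Y₀ ∣ (ℕ.≤-trans U≤L (ℕ.n≤1+n L)) ⟩
        suc L * ∣ Y₀ ∣            ∎)
        where
        e : ∀ a x → a * (4 * x) ≡ 4 * a * x
        e = solve-∀
      Y₀≤ : ∣ Y₀ ∣ ≤ ∣ Y ∣ + ∣ B ∣
      Y₀≤ = ∣∣≤∣─∣+∣∣ Y₀ B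
      2B≤ : 2 * ∣ B ∣ ≤ ∣ Y₀ ∣
      -- `F` and `spent` each have at most a quarter of the size of `Y₀`.
      2B≤ = ℕ.*-cancelˡ-≤ 2 (begin
        2 * (2 * ∣ B ∣)                   ≤⟨ ℕ.*-monoʳ-≤ 2 (ℕ.*-monoʳ-≤ 2 (∣∪∣≤ F spent)) ⟩
        2 * (2 * (∣ F ∣ + ∣ spent ∣))     ≡⟨ e ∣ F ∣ ∣ spent ∣ ⟩
        4 * ∣ F ∣ + 4 * ∣ spent ∣         ≤⟨ ℕ.+-mono-≤ 4F≤ spent≤ ⟩
        ∣ Y₀ ∣ + ∣ Y₀ ∣                   ≡⟨ cong (λ x → ∣ Y₀ ∣ + x) (sym (ℕ.+-identityʳ ∣ Y₀ ∣)) ⟩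
        2 * ∣ Y₀ ∣                        ∎)
        where
        e : ∀ x y → 2 * (2 * (x + y)) ≡ 4 * x + 4 * y
        e = solve-∀
        4F≤ : 4 * ∣ F ∣ ≤ ∣ Y₀ ∣
        4F≤ = begin
          4 * ∣ F ∣                          ≤⟨ ℕ.*-monoʳ-≤ 4 F≤ ⟩
          4 * (c * Δ)                        ≡⟨ sym (ℕ.*-assoc 4 c Δ) ⟩
          4 * c * Δ                          ≤⟨ ℕ.m≤m+n _ _ ⟩
          4 * c * Δ + 2 * (m * k) * ∣ A ∣    ≤⟨ ℕ.<⇒≤ Y₀-big ⟩
          ∣ Y₀ ∣                             ∎
      B≤Y : ∣ B ∣ ≤ ∣ Y ∣
      B≤Y = ℕ.+-cancelʳ-≤ (∣ B ∣) _ _ (begin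
        ∣ B ∣ + ∣ B ∣    ≡⟨ cong (λ x → ∣ B ∣ + x) (sym (ℕ.+-identityʳ ∣ B ∣)) ⟩
        2 * ∣ B ∣        ≤⟨ 2B≤ ⟩
        ∣ Y₀ ∣           ≤⟨ Y₀≤ ⟩
        ∣ Y ∣ + ∣ B ∣    ∎)
      D<Y : (m * k) * ∣ A′ ∣ < ∣ Y ∣
      D<Y = ℕ.*-cancelˡ-< 2 _ _ (begin-strict
        2 * ((m * k) * ∣ A′ ∣)             ≤⟨ ℕ.*-monoʳ-≤ 2 (ℕ.*-monoʳ-≤ (m * k) (p⊆q⇒∣p∣≤∣q∣ (proj₁ ∘ ∈⟨⟩⁻ far?))) ⟩
        2 * ((m * k) * ∣ A ∣)              ≡⟨ sym (ℕ.*-assoc 2 (m * k) ∣ A ∣) ⟩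
        2 * (m * k) * ∣ A ∣                ≤⟨ ℕ.m≤n+m _ (4 * c * Δ) ⟩
        4 * c * Δ + 2 * (m * k) * ∣ A ∣    <⟨ Y₀-big ⟩
        ∣ Y₀ ∣                             ≤⟨ Y₀≤ ⟩
        ∣ Y ∣ + ∣ B ∣                      ≤⟨ ℕ.+-monoʳ-≤ ∣ Y ∣ B≤Y ⟩
        ∣ Y ∣ + ∣ Y ∣                      ≡⟨ cong (λ x → ∣ Y ∣ + x) (sym (ℕ.+-identityʳ ∣ Y ∣)) ⟩
        2 * ∣ Y ∣                          ∎)

      ∉heavy : ∀ {v} → v ∉ B → v ∉ heavy
      ∉heavy v∉ h = v∉ (x∈p∪q⁺ (inj₁ (x∈p∪q⁺ (inj₁ (x∈p∪q⁺ (inj₁ h))))))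
      ∉ball : ∀ {v} → v ∉ B → v ∉ ball G C r
      ∉ball v∉ h = v∉ (x∈p∪q⁺ (inj₁ (x∈p∪q⁺ (inj₁ (x∈p∪q⁺ (inj₂ h))))))
      ∉used : ∀ {v} → v ∉ B → v ∉ used
      ∉used v∉ h = v∉ (x∈p∪q⁺ (inj₁ (x∈p∪q⁺ (inj₂ h))))
      ∉spent : ∀ {v} → v ∉ B → v ∉ spent
      ∉spent v∉ h = v∉ (x∈p∪q⁺ (inj₂ h))

      A⊆ball : A ⊆ ball G C r
      A⊆ball a∈ = ∈ball⁺ G (A⊆C a∈) (inj₂ (proj₂ (∈neighbours⁻ G (A⊆ a∈))))

      level : Frontier G C A′ Y B
      level = record
        { W⊆C = proj₁ ∘ ∈N⁻ G ∘ proj₁ ∘ ∈─⁻ N[A] (ball G C r) ∘ proj₁ ∘ ∈─⁻ Y₀ B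
        ; W∉B = proj₂ ∘ ∈─⁻ Y₀ B
        ; M∉W = λ a∈ a∈Y → ∉ball (proj₂ (∈─⁻ Y₀ B a∈Y)) (A⊆ball (proj₁ (∈⟨⟩⁻ far? a∈)))
        ; covered = covered
        ; apart = λ a∈ v∈ v∉B v∉Y nr → v∉Y (x∈p∧x∉q⇒x∈p─q (x∈p∧x∉q⇒x∈p─q
            (∈N⁺ G v∈ (proj₁ (∈⟨⟩⁻ far? a∈)) nr) (∉ball v∉B)) v∉B) }
        where
        covered : ∀ {w} → w ∈ Y → ∃[ a ] (a ∈ A′ × Adj G a w)
        -- As `w` is not spent, its parent is not near `U`. The parent differs from `w`, since `A`
        -- lies in the forbidden ball of `r`.
        covered {w} w∈ = parent w , ∈⟨⟩⁺ far? (proj₁ ok , λ an → ∉spent w∉B (∈succsOf⁺ spoils? w∈Y₀ an)) ,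
          [ (λ eq → ⊥-elim (∉ball w∉B (subst (_∈ ball G C r) eq (A⊆ball (proj₁ ok))))) , (λ adj → adj) ]′ (proj₂ ok)
          where
          w∈Y₀ : w ∈ Y₀
          w∈Y₀ = proj₁ (∈─⁻ Y₀ B w∈)
          w∉B : w ∉ B
          w∉B = proj₂ (∈─⁻ Y₀ B w∈)
          ok : parent w ∈ A × Near G (parent w) w
          ok = parent-ok w∈Y₀

      found : ∃[ a ] (a ∈ A′ × BroomAt G ℓ k a (λ v → v ∈ C × v ∉ B))
      found = reaches G X m nbrs-rich k ℓ N (ℕ.≤-trans (ℕ.m≤m+n _ _) N≥) C⊆X
        (C⊆X ∘ A⊆C ∘ proj₁ ∘ ∈⟨⟩⁻ far?) expanding level
        (∣∣>0⇒nonempty Y (ℕ.≤-<-trans z≤n D<Y)) B≤Y D<Y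

      a = proj₁ found
      a∈A : a ∈ A
      a∈A = proj₁ (∈⟨⟩⁻ far? (proj₁ (proj₂ found)))
      -- `A` is stable, so `a` is near a parent only if it is that parent. Hence `a` spoils only its
      -- own children, at most `Δ` vertices.
      a-light : Light a
      a-light = A⊆C a∈A , λ a∈h → ℕ.<⇒≱ (proj₂ (∈⟨⟩⁻ heavy? a∈h)) (begin
        K * ∣ spoilt a ∣                   ≤⟨ ℕ.*-monoʳ-≤ K (p⊆q⇒∣p∣≤∣q∣ sub) ⟩
        K * ∣ ball G C a ∣                     ≤⟨ ℕ.*-monoʳ-≤ K (r-max a (A⊆C a∈A)) ⟩
        K * Δ                              ≤⟨ ℕ.*-monoˡ-≤ Δ (ℕ.≤-trans (ℕ.≤-trans (ℕ.m≤m+n K 1) (ℕ.m≤m+n (K + 1) L)) (ℕ.m≤n*m c 4)) ⟩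
        4 * c * Δ                          ≤⟨ ℕ.m≤m+n _ _ ⟩
        4 * c * Δ + 2 * (m * k) * ∣ A ∣    ≤⟨ ℕ.<⇒≤ Y₀-big ⟩
        ∣ Y₀ ∣                             ∎)
        where
        sub : spoilt a ⊆ ball G C a
        sub {y} y∈ = ∈ball⁺ G (proj₁ (∈N⁻ G (proj₁ (∈─⁻ N[A] (ball G C r) (proj₁ y∈Y₀×near)))))
          ([ (λ eq → subst (λ x → Near G x y) eq (proj₂ ok))
           , (λ adj → ⊥-elim (A-stable _ (proj₁ ok) _ a∈A adj)) ]′ (proj₂ y∈Y₀×near))
          where
          y∈Y₀×near : y ∈ Y₀ × Near G (parent y) a
          y∈Y₀×near = ∈succs⁻ spoils? y∈
          ok : parent y ∈ A × Near G (parent y) y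
          ok = parent-ok (proj₁ y∈Y₀×near)

      broom-at : BroomAt G (suc ℓ) k r (λ v → Light v × ¬ Any (λ u → Near G u v) U)
      broom-at = extend G (proj₂ (∈neighbours⁻ G (A⊆ a∈A)))
        (a-light , λ an → proj₂ (∈⟨⟩⁻ far? (proj₁ (proj₂ found))) (Any.map (near-sym G) an))
        (λ (v∈ , v∉B) → ((v∈ , ∉heavy v∉B) , λ an → ∉used v∉B
            (∈succsOf⁺ (near? G) v∈ an)) ,
          λ nr → ∉ball v∉B (∈ball⁺ G v∈ nr))
        (proj₂ (proj₂ found))

    size : ∀ {s} (ℓ k : Fin s → ℕ) → ℕ
    size ℓ k = sum (λ i → ℓ i + k i)

    record Brooms {s} (ℓ k : Fin s → ℕ) : Set where
      field
        used      : List (Fin n)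
        all-light : All Light used
        length≤   : length used ≤ size ℓ k
        brooms    : ∀ i → BroomAt G (ℓ i) (k i) r (_∈ˡ used)
        cross     : ∀ {i j} → i ≢ j → ∀ u v → u ≢ root → v ≢ root →
                    ¬ Near G (to (embedding (brooms i)) u) (to (embedding (brooms j)) v)

    -- Each new broom is found away from the vertices of the earlier ones. Lightness is carried
    -- along because it leaves enough of `Y₀` for the next round.
    collect : ∀ {s} (ℓ k : Fin s → ℕ) → (∀ i → 1 ≤ ℓ i) → (∀ i → demand m L (ℓ i) (k i) ≤ N) → size ℓ k ≤ L → Brooms ℓ k
    collect {zero} ℓ k _ _ _ = record
      { used = [] ; all-light = [] ; length≤ = z≤n ; brooms = λ () ; cross = λ { {()} } }
    collect {suc s} ℓ k 1≤ℓ N≥ ≤L = record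
      { used = vertices new ++ used
      ; all-light = All.++⁺ (All.map proj₁ (vertices-all new)) all-light
      ; length≤ = ℕ.≤-trans (ℕ.≤-reflexive (trans (length-++ (vertices new)) (cong (_+ length used) (length-vertices new))))
                    (ℕ.+-monoʳ-≤ _ length≤)
      ; brooms = all-brooms
      ; cross = all-cross }
      where
      rest : Brooms (ℓ ∘ suc) (k ∘ suc)
      rest = collect (ℓ ∘ suc) (k ∘ suc) (1≤ℓ ∘ suc) (N≥ ∘ suc) (ℕ.≤-trans (ℕ.m≤n+m _ (ℓ zero + k zero)) ≤L)
      open Brooms rest
      new = next (ℓ zero) (k zero) (1≤ℓ zero) (N≥ zero) used all-light
              (ℕ.≤-trans length≤ (ℕ.≤-trans (ℕ.m≤n+m _ (ℓ zero + k zero)) ≤L))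
      all-brooms : ∀ i → BroomAt G (ℓ i) (k i) r (_∈ˡ (vertices new ++ used))
      all-brooms zero = record { embedding = embedding new ; to-root = to-root new
                               ; to-other = λ v v≢ → ∈-++⁺ˡ (∈-vertices new v v≢) }
      all-brooms (suc i) = weaken G (∈-++⁺ʳ (vertices new)) (brooms i)
      new-cross : ∀ i u v → u ≢ root → v ≢ root →
                  ¬ Near G (to (embedding (brooms i)) u) (to (embedding new) v)
      new-cross i u v u≢ v≢ nr = proj₂ (to-other new v v≢)
        (Any.map (λ eq → subst (λ x → Near G x _) eq nr) (to-other (brooms i) u u≢))
      all-cross : ∀ {i j} → i ≢ j → ∀ u v → u ≢ root → v ≢ root →
                  ¬ Near G (to (embedding (all-brooms i)) u) (to (embedding (all-brooms j)) v)
      all-cross {zero} {zero} i≢j = ⊥-elim (i≢j refl)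
      all-cross {zero} {suc j} _ u v u≢ v≢ nr = new-cross j v u v≢ u≢ (near-sym G nr)
      all-cross {suc i} {zero} _ u v u≢ v≢ nr = new-cross i u v u≢ v≢ nr
      all-cross {suc i} {suc j} i≢j = cross (i≢j ∘ cong suc)

-- Induction on the clique number

bounded : ∀ {s} (g : Fin s → ℕ) → ∃[ b ] (∀ i → g i ≤ b)
bounded {zero}  g = 0 , λ ()
bounded {suc s} g with bounded (g ∘ suc)
... | b , g≤b = g zero + b , λ { zero → ℕ.m≤m+n _ _ ; (suc i) → ℕ.≤-trans (g≤b i) (ℕ.m≤n+m b (g zero)) }

module _ {s : ℕ} (ℓ k : Fin s → ℕ) (1≤ℓ : ∀ i → 1 ≤ ℓ i) where

  Multibroom : Graph (Identified {V = λ i → BroomVertex (ℓ i) (k i)} (λ i → root))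
  Multibroom = identifyRoots (λ i → broom (ℓ i) (k i)) (λ i → root)

  expanding⇒↪ : ∀ {m N L} → L ≡ sum (λ i → ℓ i + k i) → (∀ i → demand m L (ℓ i) (k i) ≤ N) →
    ∀ {n} (G : Graph (Fin n)) {X C} → NeighbourhoodsRich G m X → C ⊆ X → Nonempty C → Expanding G (suc N) C →
    Multibroom ↪ G
  expanding⇒↪ {m} {N} {L} refl N≥ G {X} {C} nbrs-rich C⊆X C≠∅ expanding =
    multibroom↪ (embedding ∘ brooms) (to-root ∘ brooms) cross
    where
    open ℕ.≤-Reasoning
    max = maximiser (λ v → ∣ ball G C v ∣) C≠∅
    r = proj₁ max
    r∈C : r ∈ C
    r∈C = proj₁ (proj₂ max)
    is-r : ∀ {u} → u ∈ ⁅ r ⁆ → u ≡ r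
    is-r = x∈⁅y⁆⇒x≡y r
    nbrs-r : Rich G m (neighbours G C r)
    nbrs-r = nbrs-rich (C⊆X r∈C) (C⊆X ∘ proj₁ ∘ ∈neighbours⁻ G) (proj₂ ∘ ∈neighbours⁻ G)
    A = proj₁ nbrs-r
    A-rich : ∣ neighbours G C r ∣ ≤ m * ∣ A ∣
    A-rich = proj₂ (proj₂ (proj₂ nbrs-r))
    N[r]⊆ball : N[_,_] G C ⁅ r ⁆ ⊆ ball G C r
    N[r]⊆ball v∈ = let v∈C , u , u∈ , near = ∈N⁻ G v∈ in ∈ball⁺ G v∈C (subst (λ u → Near G u _) (is-r u∈) near)
    ⁅r⁆-stable : Stable G ⁅ r ⁆
    ⁅r⁆-stable u u∈ v v∈ a = irrefl G (subst₂ (Adj G) (is-r u∈) (is-r v∈) a)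
    0<nbrs : 0 < ∣ neighbours G C r ∣
    -- Expansion of the single vertex `r` by a positive factor gives it a neighbour. The factor is
    -- `suc N` because `N` may be zero when there are no brooms.
    0<nbrs = ℕ.≤-pred (begin
      2                           ≤⟨ s≤s (ℕ.≤-trans (s≤s z≤n) (ℕ.≤-reflexive (sym (ℕ.*-identityʳ (suc N))))) ⟩
      suc (suc N * 1)             ≡⟨ cong (λ x → suc (suc N * x)) (sym (∣⁅x⁆∣≡1 r)) ⟩
      suc (suc N * ∣ ⁅ r ⁆ ∣)     ≤⟨ expanding ⁅ r ⁆ (λ u∈ → subst (_∈ C) (sym (is-r u∈)) r∈C) ⁅r⁆-stable (r , x∈⁅x⁆ r) ⟩
      ∣ N[_,_] G C ⁅ r ⁆ ∣        ≤⟨ p⊆q⇒∣p∣≤∣q∣ N[r]⊆ball ⟩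
      ∣ ball G C r ∣              ≤⟨ ∣ball∣≤ G C r ⟩
      suc ∣ neighbours G C r ∣    ∎)
    0<A : 0 < ∣ A ∣
    0<A = ℕ.*-cancelˡ-< m 0 ∣ A ∣ (ℕ.≤-<-trans (ℕ.≤-reflexive (ℕ.*-zeroʳ m)) (ℕ.<-≤-trans 0<nbrs A-rich))
    open Brooms (collect G X m nbrs-rich C⊆X (suc N) expanding L (proj₂ (proj₂ max))
      (proj₁ (proj₂ nbrs-r)) (proj₁ (proj₂ (proj₂ nbrs-r))) A-rich 0<A ℓ k 1≤ℓ
      (λ i → ℕ.≤-trans (N≥ i) (ℕ.n≤1+n N)) ℕ.≤-refl)

  -- One step of the induction. The constant is fixed before `G` and `X`, since it depends only on
  -- `m` and the multibroom.
  rich-neighbourhoods⇒rich : ∀ m → ∃[ N ] (∀ {n} (G : Graph (Fin n)) X → NeighbourhoodsRich G m X →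
    ¬ (Multibroom ↪ G) → Rich G N X)
  rich-neighbourhoods⇒rich m = suc (proj₁ bound) , λ G X nbrs-rich free →
    [ (λ rich → rich)
    , (λ (_ , C⊆X , C≠∅ , ex) → ⊥-elim (free (expanding⇒↪ refl (proj₂ bound) G nbrs-rich C⊆X C≠∅ ex)))
    ]′ (rich-or-expanding G (suc (proj₁ bound)) X)
    where
    bound : ∃[ b ] (∀ i → demand m (sum (λ i → ℓ i + k i)) (ℓ i) (k i) ≤ b)
    bound = bounded _

  -- A clique among neighbours of `y` extends by `y`, so the induction hypothesis applies within
  -- neighbourhoods. At the base no clique on one vertex exists and `X` is empty.
  clique-free⇒rich : ∀ κ → ∃[ N ] (∀ {n} (G : Graph (Fin n)) X → ¬ (Multibroom ↪ G) →
    ¬ CliqueIn {G = G} (suc κ) X → Rich G N X)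
  clique-free⇒rich zero = 0 , λ G X _ no-clique → ∅ , ⊥-elim ∘ ∉⊥ , (λ _ u∈ → ⊥-elim (∉⊥ u∈)) ,
    ℕ.≤-reflexive (empty⇒∣∣≡0 X λ x x∈ → no-clique ((λ _ → x) , (λ _ → x∈) ,
      λ { {zero} {zero} i≢j → ⊥-elim (i≢j refl) }))
  clique-free⇒rich (suc κ) = proj₁ step-up , λ G X free no-clique → proj₂ step-up G X
      (λ y∈ Q⊆X adj → proj₂ (clique-free⇒rich κ) G _ free (no-clique ∘ clique-suc {G = G} y∈ Q⊆X adj)) free
    where step-up = rich-neighbourhoods⇒rich (proj₁ (clique-free⇒rich κ))

-- The rational constant and the theorem

-- The denominator `suc m` is positive even for `m` zero. Unnormalised fractions reduce the claim to
-- a cross-multiplied inequality in ℕ.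
1/suc*-≤ : ∀ m n a → n ≤ m * a → (+ 1 / suc m) ℚ.* (+ n / 1) ℚ.≤ (+ a / 1)
1/suc*-≤ m n a n≤ = ℚ.toℚᵘ-cancel-≤ (begin
  ℚ.toℚᵘ ((+ 1 / suc m) ℚ.* (+ n / 1))             ≃⟨ ℚ.toℚᵘ-homo-* (+ 1 / suc m) (+ n / 1) ⟩
  ℚ.toℚᵘ (+ 1 / suc m) ℚᵘ.* ℚ.toℚᵘ (+ n / 1)       ≃⟨ ℚᵘ.*-cong (ℚ.toℚᵘ-fromℚᵘ (mkℚᵘ (+ 1) m)) (ℚ.toℚᵘ-fromℚᵘ (mkℚᵘ (+ n) 0)) ⟩
  mkℚᵘ (+ 1) m ℚᵘ.* mkℚᵘ (+ n) 0                   ≤⟨ *≤* (subst₂ ℤ._≤_ lhs rhs (ℤ.+≤+ bound)) ⟩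
  mkℚᵘ (+ a) 0                                     ≃⟨ ℚᵘ.≃-sym (ℚ.toℚᵘ-fromℚᵘ (mkℚᵘ (+ a) 0)) ⟩
  ℚ.toℚᵘ (+ a / 1)                                 ∎)
  where
  open ℚᵘ.≤-Reasoning
  bound : n ≤ a * suc m
  bound = ℕ.≤-trans n≤ (ℕ.≤-trans (ℕ.m≤n+m (m * a) a) (ℕ.≤-reflexive (ℕ.*-comm (suc m) a)))
  lhs : + n ≡ (+ 1 ℤ.* + n) ℤ.* + 1
  lhs = sym (trans (ℤ.*-identityʳ _) (ℤ.*-identityˡ (+ n)))
  rhs : + (a * suc m) ≡ + a ℤ.* + (suc m * 1)
  rhs = trans (cong (λ x → + (a * x)) (sym (ℕ.*-identityʳ (suc m)))) (ℤ.pos-* a (suc m * 1))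

mainTheorem5 : ∀ {t : ℕ} (T : Graph (Fin t)) → IsMultibroom T →
    ∀ (k : ℕ) → 1 ≤ k →
    ∃[ c ] (0ℚ ℚ.< c ×
    (∀ {n : ℕ} (G : Graph (Fin n)) →
    G IsFreeOf T → G IsFreeOf complete (suc k) →
    c ℚ.* (+ order G / 1) ℚ.≤ (+ α G / 1)))
mainTheorem5 T (s , ℓ , m , 1≤ℓ , T≅) k _ =
  + 1 / suc N , ℚ.positive⁻¹ (+ 1 / suc N) {{ℚ.normalize-pos 1 (suc N)}} , λ {n} G T-free K-free →
  let S , _ , stable , le = proj₂ (clique-free⇒rich ℓ m 1≤ℓ k) G full
        (λ e → ↪⇒¬free (≅-↪ T≅ e) T-free) (λ clique → ↪⇒¬free (clique⇒↪ {G = G} clique) K-free)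
  in 1/suc*-≤ N n (α G) (ℕ.≤-trans (ℕ.≤-reflexive (sym (∣⊤∣≡n n)))
       (ℕ.≤-trans le (ℕ.*-monoʳ-≤ N (stable⇒∣∣≤α G S stable))))
  where
  N : ℕ
  N = proj₁ (clique-free⇒rich ℓ m 1≤ℓ k)
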